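{- The expected number of diagonal cells containing a $1$ in a uniformly random type-B permutation tableau of size $n$ equals $\dfrac{n}{2}$.
   Context: A Ferrers diagram is a left-justified array of cells whose row lengths weakly decrease from top to bottom (rows of length $0$ are allowed). Its half-perimeter is the number of rows plus the number of columns. If the diagram has $c$ columns, the shifted Ferrers diagram is obtained by inserting $c$ new left-justified rows above it, of lengths $c,c-1,\dots,1$ from top to bottom; the rightmost cell of each inserted row is a diagonal cell. A type-B permutation tableau of size $n$ is a filling of a shifted Ferrers diagram of half-perimeter $n$ with $0$'s and $1$'s such that: (1) every column contains at least one $1$; (2) no $0$ has both a $1$ above it in its column and a $1$ to its left in its row; (3) if a diagonal cell contains $0$ then every cell of its row contains $0$. Let $\mathcal{B}_n$ be the set of such tableaux with uniform probability measure $\mathbb{P}_n$ and expectation $\mathbb{E}_n$.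
   Formalization: The inserted rows have lengths 1, 2, …, c from top to bottom, not c, c−1, …, 1 (with that order the mean at n = 3 is 82/52, not 3/2); columns of length 0 are allowed in the Ferrers diagram (otherwise the mean at n = 1 is 0). -}

module Defs where

open import Data.Bool using (Bool; true; false)
import Data.Bool.Properties as Bool
open import Data.Fin as Fin using (Fin; toℕ; fromℕ<; _↑ˡ_)
import Data.Fin.Properties as Fin
open import Data.Integer using (+_)
open import Data.Irrelevant using ([_])
open import Data.List as List using (List; []; _∷_; _++_; length; filter; allFin; concatMap)
open import Data.List.Membership.Propositional using (_∈_)
open import Data.List.Membership.Propositional.Properties using (∈-map⁺; ∈-map⁻; ∈-filter⁺; ∈-concatMap⁺; ∈-concatMap⁻; ∈-allFin)
open import Data.List.Relation.Unary.AllPairs using ([]; _∷_)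
open import Data.List.Relation.Unary.Any as Any using (here; there)
open import Data.List.Relation.Unary.Unique.Propositional using (Unique)
open import Data.List.Relation.Unary.Unique.Propositional.Properties as Unique using (Unique[x∷xs]⇒x∉xs)
open import Data.Maybe using (Maybe; just; nothing)
import Data.Maybe.Properties as Maybe
open import Data.Nat using (ℕ; zero; suc; _+_; _∸_; _≤_; _≥_; _<_; s≤s; z≤n; NonZero)
import Data.Nat.Properties as ℕ
open import Data.Product using (Σ; ∃; ∃-syntax; _×_; _,_; proj₁)
open import Data.Rational as ℚ using (ℚ; 0ℚ; _/_)
open import Data.Refinement using (Refinement; Refinement-syntax; value; _,_)
open import Data.Vec as Vec using (Vec; []; _∷_; tabulate)
open import Data.Vec.Relation.Unary.All as All using (All; []; _∷_)
import Data.Vec.Relation.Unary.All.Properties as All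
open import Data.Vec.Relation.Unary.Linked as Linked using (Linked; []; [-]; _∷_)
open import Function using (_∘_)
open import Relation.Binary.PropositionalEquality using (_≡_; refl; sym; trans; cong; subst)
open import Relation.Nullary using (Dec; yes; no; ¬_)
open import Relation.Nullary.Decidable using (_×-dec_; _→-dec_; ¬?; map′; recompute)
open import Relation.Unary using (Decidable)

-- Columns, like rows, may have length 0: `columns` is part of the data and
-- the row lengths are only bounded by it (a partition in a rows × columns
-- box).  The side conditions are irrelevant fields, so that two diagrams
-- are equal as soon as their shapes are.

record FerrersDiagram : Set where
  constructor mkFerrers
  field
    rows columns : ℕ
    rowLengths   : Vec ℕ rows
    .bounded     : All (_≤ columns) rowLengths
    .decreasing  : Linked _≥_ rowLengths

open FerrersDiagram public

halfPerimeter : FerrersDiagram → ℕ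
halfPerimeter D = rows D + columns D

-- The inserted rows have lengths 1, 2, …, c from top to bottom, so that the
-- d-th of them (counting from 0) has its diagonal cell in column d, and the
-- diagonal cell of a column is its topmost cell.  This order is essential:
-- with c, c - 1, …, 1 from top to bottom there are 52 fillings for n = 3
-- instead of 2³ · 3! = 48, with 82 diagonal 1's in total.

shiftedRowLengths : (D : FerrersDiagram) → Vec ℕ (columns D + rows D)
shiftedRowLengths D = tabulate {n = columns D} (suc ∘ toℕ) Vec.++ rowLengths D

-- true is 1, false is 0.
Filling : FerrersDiagram → Set
Filling D = All (Vec Bool) (shiftedRowLengths D)

_‼_ : {A : Set} {m : ℕ} → Vec A m → ℕ → Maybe A
[]       ‼ _     = nothing
(x ∷ _)  ‼ zero  = just x
(_ ∷ xs) ‼ suc j = xs ‼ j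

module _ (D : FerrersDiagram) (T : Filling D) where

  Row Column : Set
  Row    = Fin (columns D + rows D)
  Column = Fin (columns D)

  -- `nothing` when (i , j) is not a cell of the shifted diagram.
  entry : Row → Column → Maybe Bool
  entry i j = All.lookup⁺ T i ‼ toℕ j

  inserted : Column → Row
  inserted d = d ↑ˡ rows D

  diagonalEntry : Column → Maybe Bool
  diagonalEntry d = entry (inserted d) d

  OneAbove : Row → Column → Set
  OneAbove i j = ∃[ i′ ] i′ Fin.< i × entry i′ j ≡ just true

  OneToLeft : Row → Column → Set
  OneToLeft i j = ∃[ j′ ] j′ Fin.< j × entry i j′ ≡ just true

  record IsTypeB : Set where
    constructor mkIsTypeB
    field
      column-has-1  : ∀ j → ∃[ i ] entry i j ≡ just true
      0-restricted  : ∀ i j → entry i j ≡ just false → ¬ (OneAbove i j × OneToLeft i j)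
      diagonal-0    : ∀ d → diagonalEntry d ≡ just false →
                      ∀ j → j Fin.≤ d → entry (inserted d) j ≡ just false

  diagonalOnes : ℕ
  diagonalOnes = length (filter (λ d → Maybe.≡-dec Bool._≟_ (diagonalEntry d) (just true)) (allFin (columns D)))

  isTypeB? : Dec IsTypeB
  isTypeB? = map′ (λ (p , q , r) → mkIsTypeB p q r)
                  (λ (mkIsTypeB p q r) → p , q , r)
    (Fin.all? (λ j → Fin.any? (λ i → entry i j ≟ just true))
     ×-dec Fin.all? (λ i → Fin.all? (λ j →
       (entry i j ≟ just false) →-dec
       ¬? (Fin.any? (λ i′ → (i′ Fin.<? i) ×-dec (entry i′ j ≟ just true))
           ×-dec Fin.any? (λ j′ → (j′ Fin.<? j) ×-dec (entry i j′ ≟ just true)))))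
     ×-dec Fin.all? (λ d → (diagonalEntry d ≟ just false) →-dec
       Fin.all? (λ j → (j Fin.≤? d) →-dec (entry (inserted d) j ≟ just false))))
    where
    _≟_ : (x y : Maybe Bool) → Dec (x ≡ y)
    _≟_ = Maybe.≡-dec Bool._≟_

record 𝓑 (n : ℕ) : Set where
  constructor mk𝓑
  field
    diagram  : FerrersDiagram
    filling  : Filling diagram
    .size    : halfPerimeter diagram ≡ n
    .isTypeB : IsTypeB diagram filling

diagonal1s : {n : ℕ} → 𝓑 n → ℕ
diagonal1s T = diagonalOnes (𝓑.diagram T) (𝓑.filling T)

record Enumeration (A : Set) : Set where
  constructor mkEnumeration
  field
    elements : List A
    unique   : Unique elements
    complete : ∀ x → x ∈ elements

open Enumeration public

sumℚ : List ℚ → ℚ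
sumℚ = List.foldr ℚ._+_ 0ℚ

expectation : {A : Set} (e : Enumeration A) .{{_ : NonZero (length (elements e))}} →
              (A → ℚ) → ℚ
expectation e X = sumℚ (List.map X (elements e)) ℚ.* (+ 1 / length (elements e))

module _ {A B : Set} where

  mapᴱ : (f : A → B) → (∀ {x y} → f x ≡ f y → x ≡ y) → (∀ y → ∃[ x ] f x ≡ y) →
         Enumeration A → Enumeration B
  mapᴱ f inj surj (mkEnumeration xs u c) = mkEnumeration (List.map f xs) (Unique.map⁺ inj u) complete′
    where
    complete′ : ∀ y → y ∈ List.map f xs
    complete′ y with surj y
    ... | x , refl = ∈-map⁺ f (c x)

module _ {A : Set} {B : A → Set} (es : ∀ x → Enumeration (B x)) where

  private
    block : (x : A) → List (Σ A B)
    block x = List.map (x ,_) (elements (es x))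

    proj₁-block : ∀ {x z} → z ∈ block x → proj₁ z ≡ x
    proj₁-block z∈ with ∈-map⁻ (_ ,_) z∈
    ... | _ , _ , refl = refl

    proj₁-blocks : ∀ {xs z} → z ∈ concatMap block xs → proj₁ z ∈ xs
    proj₁-blocks z∈ = Any.map proj₁-block (∈-concatMap⁻ block z∈)

    ,-inj : ∀ {x} {y z : B x} → _≡_ {A = Σ A B} (x , y) (x , z) → y ≡ z
    ,-inj refl = refl

    unique-blocks : ∀ xs → Unique xs → Unique (concatMap block xs)
    unique-blocks []       []        = []
    unique-blocks (x ∷ xs) u@(_ ∷ us) =
      Unique.++⁺ (Unique.map⁺ ,-inj (unique (es x))) (unique-blocks xs us)
        (λ (z∈₁ , z∈₂) → Unique[x∷xs]⇒x∉xs u (subst (_∈ xs) (proj₁-block z∈₁) (proj₁-blocks z∈₂)))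

  Σᴱ : Enumeration A → Enumeration (Σ A B)
  Σᴱ (mkEnumeration xs u c) = mkEnumeration (concatMap block xs) (unique-blocks xs u)
    (λ (x , y) → ∈-concatMap⁺ block (Any.map (λ { refl → ∈-map⁺ (x ,_) (complete (es x) y) }) (c x)))

module _ {A : Set} {P : A → Set} (P? : Decidable P) where

  private
    select : List A → List [ x ∈ A ∣ P x ]
    select []       = []
    select (x ∷ xs) with P? x
    ... | yes p = (x , [ p ]) ∷ select xs
    ... | no _  = select xs

    map-value-select : ∀ xs → List.map value (select xs) ≡ filter P? xs
    map-value-select []       = refl
    map-value-select (x ∷ xs) with P? x
    ... | yes p = cong (x ∷_) (map-value-select xs)
    ... | no _  = map-value-select xs

    value-injective : {x y : [ x ∈ A ∣ P x ]} → value x ≡ value y → x ≡ y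
    value-injective refl = refl

  refineᴱ : Enumeration A → Enumeration [ x ∈ A ∣ P x ]
  refineᴱ (mkEnumeration xs u c) = mkEnumeration (select xs)
    (Unique.map⁻ (subst Unique (sym (map-value-select xs)) (Unique.filter⁺ P? u)))
    complete′
    where
    complete′ : ∀ y → y ∈ select xs
    complete′ (x , [ p ]) with ∈-map⁻ value (subst (x ∈_) (sym (map-value-select xs)) (∈-filter⁺ P? (c x) (recompute (P? x) p)))
    ... | y , y∈ , eq = subst (_∈ select xs) (sym (value-injective eq)) y∈

Boolᴱ : Enumeration Bool
Boolᴱ = mkEnumeration (false ∷ true ∷ []) (((λ ()) All′.∷ All′.[]) ∷ All′.[] ∷ [])
  (λ { false → here refl ; true → there (here refl) })
  where import Data.List.Relation.Unary.All as All′

Finᴱ : ∀ n → Enumeration (Fin n)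
Finᴱ n = mkEnumeration (allFin n) (Unique.allFin⁺ n) ∈-allFin

Vecᴱ : {A : Set} → Enumeration A → ∀ n → Enumeration (Vec A n)
Vecᴱ e zero    = mkEnumeration ([] ∷ []) (Data.List.Relation.Unary.All.[] ∷ []) (λ { [] → here refl })
  where import Data.List.Relation.Unary.All
Vecᴱ e (suc n) = mapᴱ (λ (x , xs) → x ∷ xs) (λ { refl → refl }) (λ { (x ∷ xs) → (x , xs) , refl })
  (Σᴱ (λ _ → Vecᴱ e n) e)

Allᴱ : {A : Set} {P : A → Set} → (∀ x → Enumeration (P x)) →
       ∀ {n} (xs : Vec A n) → Enumeration (All P xs)
Allᴱ es []       = mkEnumeration ([] ∷ []) (Data.List.Relation.Unary.All.[] ∷ []) (λ { [] → here refl })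
  where import Data.List.Relation.Unary.All
Allᴱ es (x ∷ xs) = mapᴱ (λ (p , ps) → p ∷ ps) (λ { refl → refl }) (λ { (p ∷ ps) → (p , ps) , refl })
  (Σᴱ (λ _ → Allᴱ es xs) (es x))

private

  -- k is the number of columns.
  RawShape : ℕ → Set
  RawShape n = Σ (Fin (suc n)) λ k → [ ls ∈ Vec (Fin (suc (toℕ k))) (n ∸ toℕ k) ∣ Linked _≥_ (Vec.map toℕ ls) ]

  bounded-map : ∀ {k m} (ls : Vec (Fin (suc k)) m) → All (_≤ k) (Vec.map toℕ ls)
  bounded-map []       = []
  bounded-map (l ∷ ls) = ℕ.≤-pred (Fin.toℕ<n l) ∷ bounded-map ls

  bounded-lift : ∀ {k m} (ls : Vec ℕ m) → All (_≤ k) ls → ∃[ ls′ ] Vec.map (toℕ {suc k}) ls′ ≡ ls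
  bounded-lift []       []       = [] , refl
  bounded-lift (l ∷ ls) (p ∷ ps) with bounded-lift ls ps
  ... | ls′ , refl = fromℕ< (s≤s p) ∷ ls′ , cong (_∷ _) (Fin.toℕ-fromℕ< (s≤s p))

  map-toℕ-injective : ∀ {k m} {ls ls′ : Vec (Fin k) m} → Vec.map toℕ ls ≡ Vec.map toℕ ls′ → ls ≡ ls′
  map-toℕ-injective {ls = []}    {[]}     _  = refl
  map-toℕ-injective {ls = l ∷ _} {l′ ∷ _} eq
    with Fin.toℕ-injective (cong Vec.head eq) | map-toℕ-injective (cong Vec.tail eq)
  ... | refl | refl = refl

  toDiagram : ∀ {n} → RawShape n → [ D ∈ FerrersDiagram ∣ halfPerimeter D ≡ n ]
  toDiagram {n} (k , ls , [ dec ]) =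
    mkFerrers (n ∸ toℕ k) (toℕ k) (Vec.map toℕ ls) (bounded-map ls) dec , [ ℕ.m∸n+n≡m (ℕ.≤-pred (Fin.toℕ<n k)) ]

  toDiagram-injective : ∀ {n} {x y : RawShape n} → toDiagram x ≡ toDiagram y → x ≡ y
  toDiagram-injective {n} {k , ls , _} {k′ , ls′ , _} eq with Fin.toℕ-injective (cong (columns ∘ value) eq)
  ... | refl with map-toℕ-injective {ls = ls} {ls′} (rowLengths-injective (cong value eq))
    where
    rowLengths-injective : ∀ {r c} {ls ls′ : Vec ℕ r} .{b b′ d d′} →
                           mkFerrers r c ls b d ≡ mkFerrers r c ls′ b′ d′ → ls ≡ ls′
    rowLengths-injective refl = refl
  ... | refl = refl

  as-toℕ : ∀ {n k} → k ≤ n → ∃[ i ] toℕ {suc n} i ≡ k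
  as-toℕ k≤n = fromℕ< (s≤s k≤n) , Fin.toℕ-fromℕ< (s≤s k≤n)

  toDiagram-surjective : ∀ {n} (D : [ D ∈ FerrersDiagram ∣ halfPerimeter D ≡ n ]) → ∃[ x ] toDiagram x ≡ D
  toDiagram-surjective {n} (mkFerrers r c ls b d , [ eq ]) = go (recompute (_ ℕ.≟ _) eq) (recompute (All.all? (ℕ._≤? c) ls) b)
    where
    go : (eq : r + c ≡ n) → All (_≤ c) ls → ∃[ x ] toDiagram x ≡ (mkFerrers r c ls b d , [ eq ])
    go eq b′ with as-toℕ (ℕ.m+n≤o⇒n≤o r (ℕ.≤-reflexive eq))
    ... | i , refl with trans (cong (_∸ toℕ i) (sym eq)) (ℕ.m+n∸n≡m r (toℕ i))
    ... | refl with bounded-lift ls b′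
    ... | ls′ , refl = (i , ls′ , [ d ]) , refl

diagramᴱ : ∀ n → Enumeration [ D ∈ FerrersDiagram ∣ halfPerimeter D ≡ n ]
diagramᴱ n = mapᴱ toDiagram toDiagram-injective toDiagram-surjective
  (Σᴱ (λ k → refineᴱ (λ ls → Linked.linked? (λ x y → y ℕ.≤? x) (Vec.map toℕ ls)) (Vecᴱ (Finᴱ (suc (toℕ k))) (n ∸ toℕ k)))
      (Finᴱ (suc n)))

𝓑ᴱ : ∀ n → Enumeration (𝓑 n)
𝓑ᴱ n = mapᴱ (λ { ((D , [ s ]) , (T , [ t ])) → mk𝓑 D T s t }) (λ { refl → refl })
  (λ { (mk𝓑 D T s t) → ((D , [ s ]) , (T , [ t ])) , refl })
  (Σᴱ (λ D → refineᴱ (isTypeB? (value D)) (Allᴱ (Vecᴱ Boolᴱ) (shiftedRowLengths (value D)))) (diagramᴱ n))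

-- The tableau with n empty rows and no columns.
empty𝓑 : ∀ n → 𝓑 n
empty𝓑 n = mk𝓑 (mkFerrers n 0 (Vec.replicate n 0) (bounded₀ n) (decreasing₀ n)) (filling₀ n) (ℕ.+-identityʳ n)
             (mkIsTypeB (λ ()) (λ _ ()) (λ ()))
  where
  bounded₀ : ∀ n → All (_≤ 0) (Vec.replicate n 0)
  bounded₀ zero    = []
  bounded₀ (suc n) = z≤n ∷ bounded₀ n

  decreasing₀ : ∀ n → Linked _≥_ (Vec.replicate n 0)
  decreasing₀ zero          = []
  decreasing₀ (suc zero)    = [-]
  decreasing₀ (suc (suc n)) = z≤n ∷ decreasing₀ (suc n)

  filling₀ : ∀ n → All (Vec Bool) (Vec.replicate n 0)
  filling₀ zero    = []
  filling₀ (suc n) = [] ∷ filling₀ n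

𝓑-nonEmpty : ∀ n → NonZero (length (elements (𝓑ᴱ n)))
𝓑-nonEmpty n = nonZero (complete (𝓑ᴱ n) (empty𝓑 n))
  where
  nonZero : ∀ {A : Set} {x : A} {xs} → x ∈ xs → NonZero (length xs)
  nonZero (here _)  = _
  nonZero (there _) = _

𝔼 : ∀ n → (𝓑 n → ℚ) → ℚ
𝔼 n = expectation (𝓑ᴱ n) {{𝓑-nonEmpty n}}

{-# OPTIONS --safe #-}

-- Follow the southeast border of the diagram to its southwest end.  If the bottom row is empty, delete it;
-- otherwise column 0 meets every row and can be deleted together with the topmost row, which is a single
-- cell.  Call a row unrestricted if it contains no 0 with a 1 above it and its diagonal cell, if any, is
-- not 0: these are the rows in which a new leftmost column may contain a 1.  If u rows are unrestricted and
-- x marks the unrestricted rows after the step, then the empty row contributes x^(u+1), the columns with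
-- diagonal 1 contribute x(1+x)^u, and those with diagonal 0 contribute x(1+x)^u - x^(u+1).  So the steps
-- that create a diagonal 1 and those that do not have the same generating function x(1+x)^u, and
-- induction on n gives 2 ∑ d(T) x^u(T) = n ∑ x^u(T) for all x, where d counts the diagonal 1s.

module Submission where

open import Defs
open import Data.Nat using (ℕ)
open import Data.Integer using (+_)
open import Data.Rational using (_/_)
open import Relation.Binary.PropositionalEquality using (_≡_)

open import Data.Bool using (Bool; true; false; _∧_; _∨_; not)
import Data.Bool.Properties as Bool
open import Data.Fin as Fin using (Fin; toℕ; fromℕ<)
import Data.Fin.Properties as Fin
import Data.Integer as ℤ
import Data.Integer.Properties as ℤ
open import Data.List as List using (List; []; _∷_; _++_; length; map; filter; concatMap)
import Data.List.Properties as List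
open import Data.List.Membership.Propositional using (_∈_; find)
open import Data.List.Membership.Propositional.Properties using (∈-map⁺; ∈-map⁻; ∈-++⁺ˡ; ∈-++⁺ʳ; ∈-++⁻; ∈-concatMap⁺; ∈-concatMap⁻)
open import Data.List.Membership.Propositional.Properties.WithK using (unique∧set⇒bag)
open import Data.List.Relation.Binary.BagAndSetEquality using (∼bag⇒↭)
open import Data.List.Relation.Binary.Permutation.Propositional using (_↭_)
import Data.List.Relation.Binary.Permutation.Propositional.Properties as Perm
import Data.List.Relation.Unary.All as ListAll
open import Data.List.Relation.Unary.AllPairs using ([]; _∷_)
open import Data.List.Relation.Unary.Any as Any using (here; there)
open import Data.List.Relation.Unary.Unique.Propositional using (Unique)
import Data.List.Relation.Unary.Unique.Propositional.Properties as Unique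
open import Data.Maybe using (Maybe; just; nothing)
open import Data.Nat using (zero; suc; _+_; _*_; _≤_; _<_; _≥_; z≤n; s≤s; NonZero; _≤′_; ≤′-reflexive; ≤′-step)
open import Data.Nat.ListAction using (sum)
open import Data.Nat.ListAction.Properties using (sum-++; sum-↭)
import Data.Nat.Properties as ℕ
open import Data.Nat.Tactic.RingSolver using (solve-∀)
open import Data.Product using (∃; ∃₂; ∃-syntax; _×_; _,_; proj₁; proj₂)
open import Data.Rational as ℚ using (ℚ; toℚᵘ)
import Data.Rational.Properties as ℚ
import Data.Rational.Unnormalised as ℚᵘ
import Data.Rational.Unnormalised.Properties as ℚᵘ
open import Data.Sum as Sum using (_⊎_; inj₁; inj₂)
open import Data.Vec as Vec using (Vec; []; _∷_; _∷ʳ_; zipWith; tabulate; fromList; toList; cast)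
import Data.Vec.Properties as Vec
open import Data.Vec.Relation.Unary.All as All using (All; []; _∷_)
import Data.Vec.Relation.Unary.All.Properties as All
open import Data.Vec.Relation.Unary.Linked as Linked using (Linked; []; [-]; _∷_)
open import Function using (_∘_; id; mk⇔)
open import Relation.Binary.PropositionalEquality using (_≢_; refl; sym; trans; cong; cong₂; subst; subst₂; module ≡-Reasoning)
open import Relation.Nullary using (yes; no; ¬_; contradiction)
open import Relation.Nullary.Decidable using (recompute)
open import Relation.Unary using (Decidable)

private variable
  A B : Set
  c i j k m n : ℕ

-- Sums over lists

∑ : (A → ℕ) → List A → ℕ
∑ f xs = sum (map f xs)

∑-++ : (f : A → ℕ) (xs ys : List A) → ∑ f (xs ++ ys) ≡ ∑ f xs + ∑ f ys
∑-++ f xs ys = trans (cong sum (List.map-++ f xs ys)) (sum-++ (map f xs) (map f ys))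

∑-cong : {f g : A → ℕ} → (∀ x → f x ≡ g x) → ∀ xs → ∑ f xs ≡ ∑ g xs
∑-cong f≗g xs = cong sum (List.map-cong f≗g xs)

∑-map : (f : B → ℕ) (g : A → B) (xs : List A) → ∑ f (map g xs) ≡ ∑ (f ∘ g) xs
∑-map f g xs = cong sum (sym (List.map-∘ xs))

∑-concatMap : (f : B → ℕ) (g : A → List B) (xs : List A) → ∑ f (concatMap g xs) ≡ ∑ (∑ f ∘ g) xs
∑-concatMap f g []       = refl
∑-concatMap f g (x ∷ xs) = trans (∑-++ f (g x) (concatMap g xs)) (cong (_+_ (∑ f (g x))) (∑-concatMap f g xs))

∑-*ˡ : (k : ℕ) (f : A → ℕ) (xs : List A) → ∑ (λ x → k * f x) xs ≡ k * ∑ f xs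
∑-*ˡ k f []       = sym (ℕ.*-zeroʳ k)
∑-*ˡ k f (x ∷ xs) = trans (cong (_+_ (k * f x)) (∑-*ˡ k f xs)) (sym (ℕ.*-distribˡ-+ k (f x) (∑ f xs)))

∑-+ : (f g : A → ℕ) (xs : List A) → ∑ (λ x → f x + g x) xs ≡ ∑ f xs + ∑ g xs
∑-+ f g []       = refl
∑-+ f g (x ∷ xs) = trans (cong (_+_ (f x + g x)) (∑-+ f g xs)) (rearrange (f x) (g x) (∑ f xs) (∑ g xs))
  where
  rearrange : ∀ a b c d → a + b + (c + d) ≡ a + c + (b + d)
  rearrange = solve-∀

∑-1 : (xs : List A) → ∑ (λ _ → 1) xs ≡ length xs
∑-1 []       = refl
∑-1 (x ∷ xs) = cong suc (∑-1 xs)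

-- Columns of 0s and 1s

-- The flags fs mark the unrestricted rows, s tells whether a 1 has already been placed above.
newColumns : Vec Bool n → Bool → List (Vec Bool n)
newColumns []           true  = [] ∷ []
newColumns []           false = []
newColumns (false ∷ fs) s     = map (false ∷_) (newColumns fs s)
newColumns (true  ∷ fs) s     = map (false ∷_) (newColumns fs s) ++ map (true ∷_) (newColumns fs true)

-- An unrestricted row stays so unless its new leftmost entry is a 0 below a 1; `s` records whether
-- a 1 has been met higher up in the column.
newFlags : Bool → Vec Bool n → Vec Bool n → Vec Bool n
newFlags s []       []       = []
newFlags s (f ∷ fs) (b ∷ bs) = (f ∧ (b ∨ not s)) ∷ newFlags (s ∨ b) fs bs

-- The monomial x^u, with u the number of unrestricted rows, evaluated at a natural number x; no
-- polynomials are needed because all identities below are proved for every x.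
weight : ℕ → Vec Bool n → ℕ
weight x []           = 1
weight x (true  ∷ fs) = x * weight x fs
weight x (false ∷ fs) = weight x fs

weight-∷ʳ : ∀ x (fs : Vec Bool n) → weight x (fs ∷ʳ true) ≡ x * weight x fs
weight-∷ʳ x []           = refl
weight-∷ʳ x (true  ∷ fs) = cong (x *_) (weight-∷ʳ x fs)
weight-∷ʳ x (false ∷ fs) = weight-∷ʳ x fs

weight-1 : (fs : Vec Bool n) → weight 1 fs ≡ 1
weight-1 []           = refl
weight-1 (true  ∷ fs) = trans (ℕ.+-identityʳ (weight 1 fs)) (weight-1 fs)
weight-1 (false ∷ fs) = weight-1 fs

-- Below a 1 the rows are independent: an unrestricted row either takes a 1 and keeps its flag
-- (factor x) or takes a 0 and loses it (factor 1), while any other row is forced to 0.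
∑-newColumns-true : ∀ x (fs : Vec Bool n) →
  ∑ (weight x ∘ newFlags true fs) (newColumns fs true) ≡ weight (suc x) fs
∑-newColumns-true x []           = refl
∑-newColumns-true x (false ∷ fs) = trans (∑-map _ (false ∷_) (newColumns fs true)) (∑-newColumns-true x fs)
∑-newColumns-true x (true ∷ fs)  = begin
  ∑ w (map (false ∷_) bss ++ map (true ∷_) bss)
    ≡⟨ ∑-++ w (map (false ∷_) bss) (map (true ∷_) bss) ⟩
  ∑ w (map (false ∷_) bss) + ∑ w (map (true ∷_) bss)
    ≡⟨ cong₂ _+_ (∑-map w (false ∷_) bss) (∑-map w (true ∷_) bss) ⟩
  ∑ v bss + ∑ (λ bs → x * v bs) bss
    ≡⟨ cong (_+_ (∑ v bss)) (∑-*ˡ x v bss) ⟩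
  suc x * ∑ v bss
    ≡⟨ cong (suc x *_) (∑-newColumns-true x fs) ⟩
  suc x * weight (suc x) fs ∎
  where
  open ≡-Reasoning
  bss = newColumns fs true
  v   = weight x ∘ newFlags true fs
  w   = weight x ∘ newFlags true (true ∷ fs)

-- With diagonal entry 0, and with the term of the empty row moved to the left to avoid a subtraction.
∑-newColumns-false : ∀ x (fs : Vec Bool n) →
  x * weight x fs + ∑ (weight x ∘ newFlags false fs) (newColumns fs false) ≡ x * weight (suc x) fs
∑-newColumns-false x []           = ℕ.+-identityʳ (x * 1)
∑-newColumns-false x (false ∷ fs) =
  trans (cong (_+_ (x * weight x fs)) (∑-map _ (false ∷_) (newColumns fs false))) (∑-newColumns-false x fs)
∑-newColumns-false x (true ∷ fs)  = begin
  x * (x * weight x fs) + ∑ w (map (false ∷_) bss₀ ++ map (true ∷_) bss₁)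
    ≡⟨ cong (_+_ (x * (x * weight x fs))) (∑-++ w (map (false ∷_) bss₀) (map (true ∷_) bss₁)) ⟩
  x * (x * weight x fs) + (∑ w (map (false ∷_) bss₀) + ∑ w (map (true ∷_) bss₁))
    ≡⟨ cong (_+_ (x * (x * weight x fs))) (cong₂ _+_ (∑-map w (false ∷_) bss₀) (∑-map w (true ∷_) bss₁)) ⟩
  x * (x * weight x fs) + (∑ (λ bs → x * v₀ bs) bss₀ + ∑ (λ bs → x * v₁ bs) bss₁)
    ≡⟨ cong (_+_ (x * (x * weight x fs))) (cong₂ _+_ (∑-*ˡ x v₀ bss₀) (∑-*ˡ x v₁ bss₁)) ⟩
  x * (x * weight x fs) + (x * ∑ v₀ bss₀ + x * ∑ v₁ bss₁)
    ≡⟨ factor x (x * weight x fs) (∑ v₀ bss₀) (∑ v₁ bss₁) ⟩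
  x * ((x * weight x fs + ∑ v₀ bss₀) + ∑ v₁ bss₁)
    ≡⟨ cong (x *_) (cong₂ _+_ (∑-newColumns-false x fs) (∑-newColumns-true x fs)) ⟩
  x * (x * weight (suc x) fs + weight (suc x) fs)
    ≡⟨ cong (x *_) (ℕ.+-comm (x * weight (suc x) fs) (weight (suc x) fs)) ⟩
  x * (suc x * weight (suc x) fs) ∎
  where
  open ≡-Reasoning
  bss₀ = newColumns fs false
  bss₁ = newColumns fs true
  v₀   = weight x ∘ newFlags false fs
  v₁   = weight x ∘ newFlags true fs
  w    = weight x ∘ newFlags false (true ∷ fs)
  factor : ∀ a b c d → a * b + (a * c + a * d) ≡ a * (b + c + d)
  factor = solve-∀

newColumns-unique : ∀ s (fs : Vec Bool n) → Unique (newColumns fs s)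
newColumns-unique true  []           = ListAll.[] ∷ []
newColumns-unique false []           = []
newColumns-unique s     (false ∷ fs) = Unique.map⁺ Vec.∷-injectiveʳ (newColumns-unique s fs)
newColumns-unique s     (true  ∷ fs) = Unique.++⁺
  (Unique.map⁺ Vec.∷-injectiveʳ (newColumns-unique s fs))
  (Unique.map⁺ Vec.∷-injectiveʳ (newColumns-unique true fs))
  λ (p , q) → disjoint (∈-map⁻ (false ∷_) p) (∈-map⁻ (true ∷_) q)
  where
  disjoint : ∀ {z : Vec Bool (suc n)} {xs ys} → ∃[ x ] x ∈ xs × z ≡ false ∷ x → ¬ (∃[ y ] y ∈ ys × z ≡ true ∷ y)
  disjoint (_ , _ , refl) (_ , _ , ())

infix 4 _∋_

_∋_ : Vec Bool n → ℕ → Set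
bs ∋ i = bs ‼ i ≡ just true

-- The first hypothesis is what conditions (2) and (3) impose on a new leftmost column, the second
-- is condition (1); with the converse below, the recursive list is exactly the set of admissible
-- columns.
∈-newColumns⁺ : ∀ s (fs bs : Vec Bool n) → (∀ i → bs ∋ i → fs ∋ i) → s ≡ true ⊎ ∃ (bs ∋_) → bs ∈ newColumns fs s
∈-newColumns⁺ true  [] [] _ _ = here refl
∈-newColumns⁺ false [] [] _ (inj₂ ())
∈-newColumns⁺ s (false ∷ fs) (true ∷ bs) ≤ _ with () ← ≤ 0 refl
∈-newColumns⁺ true (false ∷ fs) (false ∷ bs) ≤ _ =
  ∈-map⁺ (false ∷_) (∈-newColumns⁺ true fs bs (≤ ∘ suc) (inj₁ refl))
∈-newColumns⁺ false (false ∷ fs) (false ∷ bs) ≤ (inj₂ (suc i , p)) =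
  ∈-map⁺ (false ∷_) (∈-newColumns⁺ false fs bs (≤ ∘ suc) (inj₂ (i , p)))
∈-newColumns⁺ s (true ∷ fs) (true ∷ bs) ≤ _ =
  ∈-++⁺ʳ (map (false ∷_) (newColumns fs s)) (∈-map⁺ (true ∷_) (∈-newColumns⁺ true fs bs (≤ ∘ suc) (inj₁ refl)))
∈-newColumns⁺ s (true ∷ fs) (false ∷ bs) ≤ (inj₁ s≡true) =
  ∈-++⁺ˡ (∈-map⁺ (false ∷_) (∈-newColumns⁺ s fs bs (≤ ∘ suc) (inj₁ s≡true)))
∈-newColumns⁺ s (true ∷ fs) (false ∷ bs) ≤ (inj₂ (suc i , p)) =
  ∈-++⁺ˡ (∈-map⁺ (false ∷_) (∈-newColumns⁺ s fs bs (≤ ∘ suc) (inj₂ (i , p))))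


∈-newColumns⁻ : ∀ s (fs bs : Vec Bool n) → bs ∈ newColumns fs s → (∀ i → bs ∋ i → fs ∋ i) × (s ≡ true ⊎ ∃ (bs ∋_))
∈-newColumns⁻ true [] .[] (here refl) = (λ _ p → p) , inj₁ refl
∈-newColumns⁻ s (false ∷ fs) bs p with ∈-map⁻ (false ∷_) p
... | bs′ , q , refl with ∈-newColumns⁻ s fs bs′ q
...   | ≤ , one = (λ { (suc i) → ≤ i }) , Sum.map₂ (λ (i , p) → suc i , p) one
∈-newColumns⁻ s (true ∷ fs) bs p with ∈-++⁻ (map (false ∷_) (newColumns fs s)) p
... | inj₁ q with ∈-map⁻ (false ∷_) q
...   | bs′ , r , refl with ∈-newColumns⁻ s fs bs′ r
...     | ≤ , one = (λ { (suc i) → ≤ i }) , Sum.map₂ (λ (i , p) → suc i , p) one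
∈-newColumns⁻ s (true ∷ fs) bs p | inj₂ q with ∈-map⁻ (true ∷_) q
...   | bs′ , r , refl with ∈-newColumns⁻ true fs bs′ r
...     | ≤ , _ = (λ { zero _ → refl ; (suc i) → ≤ i }) , inj₂ (0 , refl)

-- Position 0 of s ∷ bs stands for the rows above, so position k + 1 is row k: row i itself is not included.
NoneUpTo : Bool → Vec Bool n → ℕ → Set
NoneUpTo s bs i = ∀ k → k ≤ i → ¬ ((s ∷ bs) ∋ k)

∈-newFlags⁺ : ∀ s (fs bs : Vec Bool n) i → fs ∋ i → (bs ‼ i ≡ just false → NoneUpTo s bs i) → newFlags s fs bs ∋ i
∈-newFlags⁺ s     (true ∷ fs) (true  ∷ bs) zero    _ _    = refl
∈-newFlags⁺ true  (true ∷ fs) (false ∷ bs) zero    _ none = contradiction refl (none refl 0 z≤n)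
∈-newFlags⁺ false (true ∷ fs) (false ∷ bs) zero    _ _    = refl
∈-newFlags⁺ s     (f ∷ fs)    (b ∷ bs)     (suc i) p none = ∈-newFlags⁺ (s ∨ b) fs bs i p λ q → merge s b (none q)
  where
  -- Positions 0 and 1 of `s ∷ b ∷ bs` collapse into position 0 of the recursive call; all later
  -- positions shift by one.
  merge : ∀ s b → NoneUpTo s (b ∷ bs) (suc i) → NoneUpTo (s ∨ b) bs i
  merge true  _    none′ zero    _   _  = none′ 0 z≤n refl
  merge false true none′ zero    _   _  = none′ 1 (s≤s z≤n) refl
  merge _     _    none′ (suc k) k≤i    = none′ (suc (suc k)) (s≤s k≤i)

∈-newFlags⁻ : ∀ s (fs bs : Vec Bool n) i → newFlags s fs bs ∋ i → fs ∋ i × (bs ‼ i ≡ just false → NoneUpTo s bs i)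
∈-newFlags⁻ s     []          []           i       ()
∈-newFlags⁻ s     (true ∷ fs) (true  ∷ bs) zero    _ = refl , λ ()
∈-newFlags⁻ false (true ∷ fs) (false ∷ bs) zero    _ = refl , λ { _ zero _ () }
∈-newFlags⁻ s     (f ∷ fs)    (b ∷ bs)     (suc i) p with ∈-newFlags⁻ (s ∨ b) fs bs i p
... | q , none = q , λ r → split s b (none r)
  where
  split : ∀ s b → NoneUpTo (s ∨ b) bs i → NoneUpTo s (b ∷ bs) (suc i)
  split true  _    none′ zero          _        _ = none′ 0 z≤n refl
  split s     true none′ (suc zero)    _        _ = none′ 0 z≤n (cong just (Bool.∨-zeroʳ s))
  split _     _    none′ (suc (suc k)) (s≤s k≤i)  = none′ (suc k) k≤i

-- Grids of cells

-- Total functions with `nothing` outside the diagram, so that a diagram can be moved along the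
-- diagonal without carrying bounds.
Grid : Set
Grid = ℕ → ℕ → Maybe Bool

infix 4 _≗₂_

_≗₂_ : Grid → Grid → Set
e ≗₂ e′ = ∀ i j → e i j ≡ e′ i j

≗₂-sym : {e e′ : Grid} → e ≗₂ e′ → e′ ≗₂ e
≗₂-sym e≗e′ i j = sym (e≗e′ i j)

Above Left : Grid → ℕ → ℕ → Set
Above e i j = ∃[ i′ ] i′ < i × e i′ j ≡ just true
Left  e i j = ∃[ j′ ] j′ < j × e i j′ ≡ just true

-- Row `i` has its diagonal cell, if any, in column `i`. For rows of the original diagram and beyond
-- the last row, `e i i` is `nothing`, so the second component holds.
Unrestricted : Grid → ℕ → Set
Unrestricted e i = (∀ j → e i j ≡ just false → ¬ Above e i j) × e i i ≢ just false

-- The premises with `just false` keep `zeros` and `diagonal` inside the diagram. The latter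
-- excludes 1s instead of asserting 0s, because positions to the right of the diagonal cell are
-- `nothing`.
record Valid (c : ℕ) (e : Grid) : Set where
  constructor mkValid
  field
    column   : ∀ j → j < c → ∃[ i ] e i j ≡ just true
    zeros    : ∀ i j → e i j ≡ just false → Above e i j → ¬ Left e i j
    diagonal : ∀ i → e i i ≡ just false → ∀ j → e i j ≢ just true

module _ {e e′ : Grid} (e≗e′ : e ≗₂ e′) where

  Above-cong : ∀ {i j} → Above e i j → Above e′ i j
  Above-cong (k , k<i , p) = k , k<i , trans (sym (e≗e′ k _)) p

  Left-cong : ∀ {i j} → Left e i j → Left e′ i j
  Left-cong (k , k<j , p) = k , k<j , trans (sym (e≗e′ _ k)) p

Unrestricted-cong : ∀ {e e′} → e ≗₂ e′ → ∀ {i} → Unrestricted e i → Unrestricted e′ i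
Unrestricted-cong e≗e′ {i} (u , d) =
  (λ j p a → u j (trans (e≗e′ i j) p) (Above-cong (≗₂-sym e≗e′) a)) , d ∘ trans (e≗e′ i i)

Valid-cong : ∀ {e e′} → e ≗₂ e′ → Valid c e → Valid c e′
Valid-cong e≗e′ (mkValid column zeros diagonal) = mkValid
  (λ j j<c → let i , p = column j j<c in i , trans (sym (e≗e′ i j)) p)
  (λ i j p a l → zeros i j (trans (e≗e′ i j) p) (Above-cong (≗₂-sym e≗e′) a) (Left-cong (≗₂-sym e≗e′) l))
  (λ i p j q → diagonal i (trans (e≗e′ i i) p) j (trans (e≗e′ i j) q))

-- The grid e moved one step down and to the right, with the new leftmost column β.
extend : (ℕ → Maybe Bool) → Grid → Grid
extend β e i       zero    = β i
extend β e zero    (suc j) = nothing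
extend β e (suc i) (suc j) = e i j

module _ {β : ℕ → Maybe Bool} {e : Grid} where

  Above-extend⁺ : ∀ {i j} → Above e i j → Above (extend β e) (suc i) (suc j)
  Above-extend⁺ (k , k<i , p) = suc k , s≤s k<i , p

  Above-extend⁻ : ∀ {i j} → Above (extend β e) (suc i) (suc j) → Above e i j
  Above-extend⁻ (suc k , s≤s k<i , p) = k , k<i , p

  -- Old cells keep what is above them and gain just one cell to their left, and diagonal cells stay
  -- on the diagonal. So a 1 in the new column is harmful only to a row with a 0 below a 1 or with
  -- diagonal entry 0.
  Valid-extend⁺ : Valid c e → ∃[ i ] β i ≡ just true → (∀ i → β (suc i) ≡ just true → Unrestricted e i) →
                  Valid (suc c) (extend β e)
  Valid-extend⁺ {c} (mkValid column zeros diagonal) one unrestricted = mkValid column′ zeros′ diagonal′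
    where
    column′ : ∀ j → j < suc c → ∃[ i ] extend β e i j ≡ just true
    column′ zero    _         = one
    column′ (suc j) (s≤s j<c) = let i , p = column j j<c in suc i , p

    zeros′ : ∀ i j → extend β e i j ≡ just false → Above (extend β e) i j → ¬ Left (extend β e) i j
    zeros′ (suc i) (suc j) p a (zero  , _       , q) = proj₁ (unrestricted i q) j p (Above-extend⁻ a)
    zeros′ (suc i) (suc j) p a (suc k , s≤s k<j , q) = zeros i j p (Above-extend⁻ a) (k , k<j , q)

    diagonal′ : ∀ i → extend β e i i ≡ just false → ∀ j → extend β e i j ≢ just true
    diagonal′ zero    p zero    q with () ← trans (sym p) q
    diagonal′ (suc i) p zero    q = proj₂ (unrestricted i q) p
    diagonal′ (suc i) p (suc j) q = diagonal i p j q

  Valid-extend⁻ : Valid (suc c) (extend β e) →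
                  Valid c e × (∃[ i ] β i ≡ just true) × (∀ i → β (suc i) ≡ just true → Unrestricted e i)
  Valid-extend⁻ {c} (mkValid column zeros diagonal) with column 0 (s≤s z≤n)
  ... | i , one = mkValid column′ zeros′ (λ i p j → diagonal (suc i) p (suc j)) , (i , one) , unrestricted
    where
    column′ : ∀ j → j < c → ∃[ i ] e i j ≡ just true
    column′ j j<c with column (suc j) (s≤s j<c)
    ... | suc i , p = i , p

    zeros′ : ∀ i j → e i j ≡ just false → Above e i j → ¬ Left e i j
    zeros′ i j p a (k , k<j , q) = zeros (suc i) (suc j) p (Above-extend⁺ a) (suc k , s≤s k<j , q)

    unrestricted : ∀ i → β (suc i) ≡ just true → Unrestricted e i
    unrestricted i q =
      (λ j p a → zeros (suc i) (suc j) p (Above-extend⁺ a) (0 , s≤s z≤n , q)) , λ p → diagonal (suc i) p 0 q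

  Unrestricted-extend-0 : β 0 ≢ just false → Unrestricted (extend β e) 0
  Unrestricted-extend-0 p = (λ { _ _ (_ , () , _) }) , p

  -- Row `i` becomes row `suc i`, so the positions `k ≤ i` of the new column are those strictly
  -- above it.
  Unrestricted-extend⁺ : ∀ i → Unrestricted e i → (β (suc i) ≡ just false → ∀ k → k ≤ i → β k ≢ just true) →
                         Unrestricted (extend β e) (suc i)
  Unrestricted-extend⁺ i (u , d) none =
    (λ { zero p (k , s≤s k≤i , q) → none p k k≤i q ; (suc j) p a → u j p (Above-extend⁻ a) }) , d

  Unrestricted-extend⁻ : ∀ i → Unrestricted (extend β e) (suc i) →
                         Unrestricted e i × (β (suc i) ≡ just false → ∀ k → k ≤ i → β k ≢ just true)
  Unrestricted-extend⁻ i (u , d) =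
    ((λ j p a → u (suc j) p (Above-extend⁺ a)) , d) , λ p k k≤i q → u 0 p (k , s≤s k≤i , q)

-- The rows of a shifted diagram

-- Row lengths are kept out of the type, so adding a column changes no index but the number of rows,
-- and tableaux are compared by plain equality.
Rows : ℕ → Set
Rows = Vec (List Bool)

cell : Rows n → Grid
cell []      _       _ = nothing
cell (r ∷ R) zero    j = fromList r ‼ j
cell (r ∷ R) (suc i) j = cell R i j

rowLength : Rows n → ℕ → ℕ
rowLength []      _       = 0
rowLength (r ∷ R) zero    = length r
rowLength (r ∷ R) (suc i) = rowLength R i

-- The `[]` becomes the new topmost inserted row, of length 1; the old inserted rows grow to lengths
-- 2, 3, ..., so the staircase is preserved.
prependColumn : Vec Bool (suc n) → Rows n → Rows (suc n)
prependColumn bs R = zipWith _∷_ bs ([] ∷ R)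

cell-∷ʳ : (R : Rows n) → cell (R ∷ʳ []) ≗₂ cell R
cell-∷ʳ []      zero    j = refl
cell-∷ʳ []      (suc i) j = refl
cell-∷ʳ (r ∷ R) zero    j = refl
cell-∷ʳ (r ∷ R) (suc i) j = cell-∷ʳ R i j

cell-zipWith-0 : ∀ (bs : Vec Bool n) R i → cell (zipWith _∷_ bs R) i 0 ≡ bs ‼ i
cell-zipWith-0 []       []      i       = refl
cell-zipWith-0 (b ∷ bs) (r ∷ R) zero    = refl
cell-zipWith-0 (b ∷ bs) (r ∷ R) (suc i) = cell-zipWith-0 bs R i

cell-zipWith-suc : ∀ (bs : Vec Bool n) R i j → cell (zipWith _∷_ bs R) i (suc j) ≡ cell R i j
cell-zipWith-suc []       []      i       j = refl
cell-zipWith-suc (b ∷ bs) (r ∷ R) zero    j = refl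
cell-zipWith-suc (b ∷ bs) (r ∷ R) (suc i) j = cell-zipWith-suc bs R i j

cell-prependColumn : ∀ bs (R : Rows n) → cell (prependColumn bs R) ≗₂ extend (bs ‼_) (cell R)
cell-prependColumn bs       R i       zero    = cell-zipWith-0 bs ([] ∷ R) i
cell-prependColumn (b ∷ bs) R zero    (suc j) = refl
cell-prependColumn (b ∷ bs) R (suc i) (suc j) = cell-zipWith-suc bs R i j

cell-outside : (R : Rows n) → n ≤ i → cell R i j ≡ nothing
cell-outside []      _         = refl
cell-outside (r ∷ R) (s≤s n≤i) = cell-outside R n≤i

rowLength-∷ʳ : ∀ (R : Rows n) i → rowLength (R ∷ʳ []) i ≡ rowLength R i
rowLength-∷ʳ []      zero    = refl
rowLength-∷ʳ []      (suc i) = refl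
rowLength-∷ʳ (r ∷ R) zero    = refl
rowLength-∷ʳ (r ∷ R) (suc i) = rowLength-∷ʳ R i

rowLength-last : ∀ (R : Rows n) r → rowLength (R ∷ʳ r) n ≡ length r
rowLength-last []      r = refl
rowLength-last (_ ∷ R) r = rowLength-last R r

rowLength-outside : (R : Rows n) → n ≤ i → rowLength R i ≡ 0
rowLength-outside []      _         = refl
rowLength-outside (r ∷ R) (s≤s n≤i) = rowLength-outside R n≤i

rowLength-zipWith : ∀ (bs : Vec Bool n) R → i < n → rowLength (zipWith _∷_ bs R) i ≡ suc (rowLength R i)
rowLength-zipWith {i = zero}  (b ∷ bs) (r ∷ R) _         = refl
rowLength-zipWith {i = suc _} (b ∷ bs) (r ∷ R) (s≤s i<n) = rowLength-zipWith bs R i<n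

-- Rows `c + k` are those of the Ferrers diagram. Past the last row the length is 0, so `box` and
-- `weak` can range over all `k`.
record Shape (c : ℕ) (R : Rows n) : Set where
  constructor mkShape
  field
    c≤n       : c ≤ n
    staircase : ∀ i → i < c → rowLength R i ≡ suc i
    box       : ∀ k → rowLength R (c + k) ≤ c
    weak      : ∀ k → rowLength R (suc (c + k)) ≤ rowLength R (c + k)

Shape-∷ʳ⁺ : (R : Rows n) → Shape c R → Shape c (R ∷ʳ [])
Shape-∷ʳ⁺ {n} {c} R (mkShape c≤n staircase box weak) = mkShape (ℕ.m≤n⇒m≤1+n c≤n)
  (λ i i<c → trans (rowLength-∷ʳ R i) (staircase i i<c))
  (λ k → subst (_≤ c) (sym (rowLength-∷ʳ R (c + k))) (box k))
  (λ k → subst₂ _≤_ (sym (rowLength-∷ʳ R (suc (c + k)))) (sym (rowLength-∷ʳ R (c + k))) (weak k))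

Shape-∷ʳ⁻ : (R : Rows n) → Shape c (R ∷ʳ []) → Shape c R
Shape-∷ʳ⁻ {n} {c} R (mkShape c≤1+n staircase box weak) = mkShape (c≤n (ℕ.m≤n⇒m<n∨m≡n c≤1+n))
  (λ i i<c → trans (sym (rowLength-∷ʳ R i)) (staircase i i<c))
  (λ k → subst (_≤ c) (rowLength-∷ʳ R (c + k)) (box k))
  (λ k → subst₂ _≤_ (rowLength-∷ʳ R (suc (c + k))) (rowLength-∷ʳ R (c + k)) (weak k))
  where
  c≤n : c < suc n ⊎ c ≡ suc n → c ≤ n
  c≤n (inj₁ (s≤s c≤n)) = c≤n
  -- Here every row would be an inserted one, and the last of these has length `suc n`, whereas the
  -- appended row is empty.
  c≤n (inj₂ refl) with () ← trans (sym (staircase n ℕ.≤-refl)) (rowLength-last R [])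

module _ (bs : Vec Bool n) (R : Rows n) where

  zipWith-≤⁺ : ∀ i m → rowLength R i ≤ m → rowLength (zipWith _∷_ bs R) i ≤ suc m
  zipWith-≤⁺ i m p with ℕ.<-≤-connex i n
  ... | inj₁ i<n = subst (_≤ suc m) (sym (rowLength-zipWith bs R i<n)) (s≤s p)
  ... | inj₂ n≤i = subst (_≤ suc m) (sym (rowLength-outside (zipWith _∷_ bs R) n≤i)) z≤n

  zipWith-≤⁻ : ∀ i m → rowLength (zipWith _∷_ bs R) i ≤ suc m → rowLength R i ≤ m
  zipWith-≤⁻ i m p with ℕ.<-≤-connex i n
  ... | inj₁ i<n = ℕ.≤-pred (subst (_≤ suc m) (rowLength-zipWith bs R i<n) p)
  ... | inj₂ n≤i = subst (_≤ m) (sym (rowLength-outside R n≤i)) z≤n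

  zipWith-weak⁺ : ∀ i → rowLength R (suc i) ≤ rowLength R i →
                  rowLength (zipWith _∷_ bs R) (suc i) ≤ rowLength (zipWith _∷_ bs R) i
  zipWith-weak⁺ i p with ℕ.<-≤-connex i n
  ... | inj₁ i<n = ℕ.≤-trans (zipWith-≤⁺ (suc i) _ p) (ℕ.≤-reflexive (sym (rowLength-zipWith bs R i<n)))
  ... | inj₂ n≤i = ℕ.≤-trans (ℕ.≤-reflexive (rowLength-outside (zipWith _∷_ bs R) (ℕ.m≤n⇒m≤1+n n≤i))) z≤n

  zipWith-weak⁻ : ∀ i → rowLength (zipWith _∷_ bs R) (suc i) ≤ rowLength (zipWith _∷_ bs R) i →
                  rowLength R (suc i) ≤ rowLength R i
  zipWith-weak⁻ i p with ℕ.<-≤-connex i n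
  ... | inj₁ i<n = zipWith-≤⁻ (suc i) _ (ℕ.≤-trans p (ℕ.≤-reflexive (rowLength-zipWith bs R i<n)))
  ... | inj₂ n≤i = ℕ.≤-trans (ℕ.≤-reflexive (rowLength-outside R (ℕ.m≤n⇒m≤1+n n≤i))) z≤n

Shape-prependColumn⁺ : ∀ bs (R : Rows n) → Shape c R → Shape (suc c) (prependColumn bs R)
Shape-prependColumn⁺ {n} {c} (b ∷ bs) R (mkShape c≤n staircase box weak) = mkShape (s≤s c≤n) staircase′
  (λ k → zipWith-≤⁺ bs R (c + k) c (box k)) (λ k → zipWith-weak⁺ bs R (c + k) (weak k))
  where
  staircase′ : ∀ i → i < suc c → rowLength (prependColumn (b ∷ bs) R) i ≡ suc i
  staircase′ zero    _         = refl
  staircase′ (suc i) (s≤s i<c) = trans (rowLength-zipWith bs R (ℕ.<-≤-trans i<c c≤n)) (cong suc (staircase i i<c))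

Shape-prependColumn⁻ : ∀ bs (R : Rows n) → Shape (suc c) (prependColumn bs R) → Shape c R
Shape-prependColumn⁻ {n} {c} (b ∷ bs) R (mkShape (s≤s c≤n) staircase box weak) = mkShape c≤n
  (λ i i<c → ℕ.suc-injective (trans (sym (rowLength-zipWith bs R (ℕ.<-≤-trans i<c c≤n))) (staircase (suc i) (s≤s i<c))))
  (λ k → zipWith-≤⁻ bs R (c + k) c (box k)) (λ k → zipWith-weak⁻ bs R (c + k) (weak k))

-- Border steps and their inverses

-- The number of columns with the rows of the shifted diagram. Their number is columns plus rows, so
-- the index `n` is the half-perimeter and each step raises it by one.
Raw : ℕ → Set
Raw n = ℕ × Rows n

data _↝_ {n : ℕ} : Raw n → Raw (suc n) → Set where
  addRow    : ∀ {c R} → (c , R) ↝ (c , R ∷ʳ [])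
  addColumn : ∀ {c R} bs → (c , R) ↝ (suc c , prependColumn bs R)

zipWith-∷-injective : ∀ (bs bs′ : Vec Bool n) (R R′ : Rows n) →
  zipWith List._∷_ bs R ≡ zipWith _∷_ bs′ R′ → bs ≡ bs′ × R ≡ R′
zipWith-∷-injective []       []         []      []        _  = refl , refl
zipWith-∷-injective (b ∷ bs) (b′ ∷ bs′) (r ∷ R) (r′ ∷ R′) eq
  with List.∷-injective (Vec.∷-injectiveˡ eq) | zipWith-∷-injective bs bs′ R R′ (Vec.∷-injectiveʳ eq)
... | refl , refl | refl , refl = refl , refl

prependColumn-injective : ∀ bs bs′ (R R′ : Rows n) → prependColumn bs R ≡ prependColumn bs′ R′ → bs ≡ bs′ × R ≡ R′
prependColumn-injective bs bs′ R R′ eq with zipWith-∷-injective bs bs′ ([] ∷ R) ([] ∷ R′) eq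
... | refl , refl = refl , refl

-- The bottom row tells the two kinds of step apart: it is nonempty after a column step and empty
-- after a row step.
prependColumn≢∷ʳ[] : ∀ bs (R : Rows n) (R′ : Rows n) → prependColumn bs R ≢ R′ ∷ʳ []
prependColumn≢∷ʳ[] {n} bs R R′ eq
  with () ← trans (sym (rowLength-zipWith bs ([] ∷ R) ℕ.≤-refl))
                  (trans (cong (λ S → rowLength S n) eq) (rowLength-last R′ []))

-- A step can be undone in only one way; hence distinct tableaux have disjoint lists of successors
-- and the enumeration repeats nothing.
↝-injective : {P P′ : Raw n} {Q Q′ : Raw (suc n)} → P ↝ Q → P′ ↝ Q′ → Q ≡ Q′ → P ≡ P′
↝-injective (addRow {c} {R}) (addRow {R = R′}) eq =
  cong₂ _,_ (cong proj₁ eq) (Vec.∷ʳ-injectiveˡ R R′ (cong proj₂ eq))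
↝-injective (addRow {R = R}) (addColumn {R = R′} bs′) eq =
  contradiction (sym (cong proj₂ eq)) (prependColumn≢∷ʳ[] bs′ R′ R)
↝-injective (addColumn {R = R} bs) (addRow {R = R′}) eq =
  contradiction (cong proj₂ eq) (prependColumn≢∷ʳ[] bs R R′)
↝-injective (addColumn bs) (addColumn bs′) eq =
  cong₂ _,_ (ℕ.suc-injective (cong proj₁ eq)) (proj₂ (prependColumn-injective bs bs′ _ _ (cong proj₂ eq)))

unzipColumn : (S : Rows n) → (∀ i → i < n → 0 < rowLength S i) → ∃₂ λ bs R → S ≡ zipWith _∷_ bs R
unzipColumn []            _        = [] , [] , refl
unzipColumn ([] ∷ S)      nonempty with () ← nonempty 0 (s≤s z≤n)
unzipColumn ((b ∷ r) ∷ S) nonempty with unzipColumn S (λ i i<n → nonempty (suc i) (s≤s i<n))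
... | bs , R , refl = b ∷ bs , r ∷ R , refl

module _ {R : Rows n} (shape : Shape c R) where
  open Shape shape

  -- Staircase rows are never empty and the lengths below them weakly decrease. Iterated, this makes
  -- column 0 meet every row as soon as the bottom row is nonempty.
  rowLength-positive-pred : ∀ i → 0 < rowLength R (suc i) → 0 < rowLength R i
  rowLength-positive-pred i p with ℕ.<-≤-connex i c
  ... | inj₁ i<c = subst (0 <_) (sym (staircase i i<c)) (s≤s z≤n)
  ... | inj₂ c≤i with ℕ.m≤n⇒∃[o]m+o≡n c≤i
  ...   | k , refl = ℕ.≤-trans p (weak k)

  rowLength-positive-≤ : i ≤ j → 0 < rowLength R j → 0 < rowLength R i
  rowLength-positive-≤ i≤j = go (ℕ.≤⇒≤′ i≤j)
    where
    go : ∀ {i j} → i ≤′ j → 0 < rowLength R j → 0 < rowLength R i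
    go (≤′-reflexive refl) p = p
    go (≤′-step i≤j)       p = go i≤j (rowLength-positive-pred _ p)

-- An empty bottom row is dropped. Otherwise column 0 is full and can be split off, which leaves
-- nothing of the topmost row.
↝-decompose : (S : Rows (suc n)) → Shape c S → ∃[ P ] P ↝ (c , S) × Shape (proj₁ P) (proj₂ P)
↝-decompose {n} {c} S shape with Vec.initLast S
... | R , []      , refl = (c , R) , addRow , Shape-∷ʳ⁻ R shape
... | R , (b ∷ r) , refl with unzipColumn S (λ i i<1+n → rowLength-positive-≤ shape (ℕ.≤-pred i<1+n) positive)
  where
  positive : 0 < rowLength S n
  positive = subst (0 <_) (sym (rowLength-last R (b ∷ r))) (s≤s z≤n)
...   | bs , R′ , eq = peel c bs R′ eq (subst (Shape c) eq shape)
  where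
  peel : ∀ c bs R′ → S ≡ zipWith _∷_ bs R′ → Shape c (zipWith _∷_ bs R′) → ∃[ P ] P ↝ (c , S) × Shape (proj₁ P) (proj₂ P)
  -- Without columns, `box` would make the top row empty; with columns, the staircase makes it a
  -- single cell.
  peel zero    (b ∷ bs) (r ∷ R′)       eq shape with () ← Shape.box shape 0
  peel (suc c) (b ∷ bs) ((_ ∷ _) ∷ R′) eq shape with () ← Shape.staircase shape 0 (s≤s z≤n)
  peel (suc c) (b ∷ bs) ([] ∷ R′)      eq shape =
    (c , R′) , subst (λ S → (c , R′) ↝ (suc c , S)) (sym eq) (addColumn (b ∷ bs)) , Shape-prependColumn⁻ (b ∷ bs) R′ shape

-- Enumeration by successive southwest border steps

-- The flags are determined by the raw tableau, as `Flagged` makes precise, and are carried along so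
-- that the next columns can be listed. Uniqueness is therefore stated for first projections.
Code : ℕ → Set
Code n = Raw n × Vec Bool n

withRow : Code n → Code (suc n)
withRow ((c , R) , fs) = (c , R ∷ʳ []) , fs ∷ʳ true

-- The new topmost row is unrestricted precisely when its only cell contains a 1.
withColumn : Code n → Vec Bool (suc n) → Code (suc n)
withColumn ((c , R) , fs) bs =
  (suc c , prependColumn bs R) , Vec.head bs ∷ newFlags (Vec.head bs) fs (Vec.tail bs)

-- The leading `true` leaves the new diagonal cell free; the `false` says that no 1 lies above it,
-- so the column must contain a 1 itself.
steps : Code n → List (Code (suc n))
steps C = withRow C ∷ map (withColumn C) (newColumns (true ∷ proj₂ C) false)

codes : ∀ n → List (Code n)
codes zero    = ((0 , []) , []) ∷ []
codes (suc n) = concatMap steps (codes n)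

steps-↝ : {C : Code n} {C′ : Code (suc n)} → C′ ∈ steps C → proj₁ C ↝ proj₁ C′
steps-↝ (here refl) = addRow
steps-↝ {C = C} (there p) with ∈-map⁻ (withColumn C) p
... | bs , _ , refl = addColumn bs

steps-unique : (C : Code n) → Unique (map proj₁ (steps C))
steps-unique C@((c , R) , fs) = ListAll.tabulate fresh ∷
  subst Unique (List.map-∘ (newColumns (true ∷ fs) false))
    (Unique.map⁺ (λ eq → proj₁ (prependColumn-injective _ _ R R (cong proj₂ eq))) (newColumns-unique false (true ∷ fs)))
  where
  fresh : ∀ {Q} → Q ∈ map proj₁ (map (withColumn C) (newColumns (true ∷ fs) false)) → (c , R ∷ʳ []) ≢ Q
  fresh p eq with ∈-map⁻ proj₁ p
  ... | _ , q , refl with ∈-map⁻ (withColumn C) q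
  ...   | bs , _ , refl = prependColumn≢∷ʳ[] bs R R (sym (cong proj₂ eq))

concatMap-steps-unique : (Cs : List (Code n)) → Unique (map proj₁ Cs) → Unique (map proj₁ (concatMap steps Cs))
concatMap-steps-unique []       _          = []
concatMap-steps-unique (C ∷ Cs) u@(_ ∷ u′) = subst Unique (sym (List.map-++ proj₁ (steps C) (concatMap steps Cs)))
  (Unique.++⁺ (steps-unique C) (concatMap-steps-unique Cs u′) λ (p , q) → disjoint (∈-map⁻ proj₁ p) (∈-map⁻ proj₁ q))
  where
  disjoint : ∀ {Q} → ∃[ C₁ ] C₁ ∈ steps C × Q ≡ proj₁ C₁ → ¬ (∃[ C₂ ] C₂ ∈ concatMap steps Cs × Q ≡ proj₁ C₂)
  disjoint (C₁ , p , refl) (C₂ , q , eq) with find (∈-concatMap⁻ steps {xs = Cs} q)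
  ... | C′ , r , q′ = Unique.Unique[x∷xs]⇒x∉xs u
    (subst (_∈ map proj₁ Cs) (sym (↝-injective (steps-↝ p) (steps-↝ q′) eq)) (∈-map⁺ proj₁ r))

codes-unique : ∀ n → Unique (map proj₁ (codes n))
codes-unique zero    = ListAll.[] ∷ []
codes-unique (suc n) = concatMap-steps-unique (codes n) (codes-unique n)

-- Correctness of the enumeration

record Tableau {n : ℕ} (P : Raw n) : Set where
  constructor mkTableau
  field
    shape : Shape (proj₁ P) (proj₂ P)
    valid : Valid (proj₁ P) (cell (proj₂ P))

-- The bound in `complete` is there because rows past the last one are vacuously unrestricted but
-- have no flag.
record Flagged {n : ℕ} (fs : Vec Bool n) (e : Grid) : Set where
  constructor mkFlagged
  field
    sound    : ∀ i → fs ∋ i → Unrestricted e i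
    complete : ∀ i → i < n → Unrestricted e i → fs ∋ i

Flagged-cong : ∀ {fs : Vec Bool n} {e e′} → e ≗₂ e′ → Flagged fs e → Flagged fs e′
Flagged-cong e≗e′ (mkFlagged sound complete) = mkFlagged
  (λ i p → Unrestricted-cong e≗e′ (sound i p))
  (λ i i<n u → complete i i<n (Unrestricted-cong (≗₂-sym e≗e′) u))

∋-bounded : (bs : Vec Bool n) → bs ∋ i → i < n
∋-bounded {i = zero}  (b ∷ bs) _ = s≤s z≤n
∋-bounded {i = suc _} (b ∷ bs) p = s≤s (∋-bounded bs p)

∋-∷ʳ⁺ : ∀ (bs : Vec Bool n) {b} → bs ∋ i → (bs ∷ʳ b) ∋ i
∋-∷ʳ⁺ {i = zero}  (b ∷ bs) p = p
∋-∷ʳ⁺ {i = suc _} (b ∷ bs) p = ∋-∷ʳ⁺ bs p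

∋-∷ʳ⁻ : ∀ (bs : Vec Bool n) {b} → (bs ∷ʳ b) ∋ i → bs ∋ i ⊎ i ≡ n
∋-∷ʳ⁻ {i = zero}  []       p = inj₂ refl
∋-∷ʳ⁻ {i = zero}  (b ∷ bs) p = inj₁ p
∋-∷ʳ⁻ {i = suc _} (b ∷ bs) p = Sum.map₂ (cong suc) (∋-∷ʳ⁻ bs p)

∋-last : (bs : Vec Bool n) → (bs ∷ʳ true) ∋ n
∋-last []       = refl
∋-last (_ ∷ bs) = ∋-last bs

-- An empty row has no 0 at all, so it is unrestricted and gets the flag `true`.
Flagged-∷ʳ : ∀ (fs : Vec Bool n) R → Flagged fs (cell R) → Flagged (fs ∷ʳ true) (cell R)
Flagged-∷ʳ {n} fs R (mkFlagged sound complete) = mkFlagged sound′ complete′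
  where
  sound′ : ∀ i → (fs ∷ʳ true) ∋ i → Unrestricted (cell R) i
  sound′ i p with ∋-∷ʳ⁻ fs p
  ... | inj₁ q    = sound i q
  ... | inj₂ refl = (λ j q _ → contradiction (trans (sym q) (cell-outside R ℕ.≤-refl)) λ ())
                  , λ q → contradiction (trans (sym q) (cell-outside R ℕ.≤-refl)) λ ()

  complete′ : ∀ i → i < suc n → Unrestricted (cell R) i → (fs ∷ʳ true) ∋ i
  complete′ i (s≤s i≤n) u with ℕ.m≤n⇒m<n∨m≡n i≤n
  ... | inj₁ i<n  = ∋-∷ʳ⁺ fs (complete i i<n u)
  ... | inj₂ refl = ∋-last fs

Flagged-extend : ∀ b {fs bs : Vec Bool n} {e} → Flagged fs e → Flagged (b ∷ newFlags b fs bs) (extend ((b ∷ bs) ‼_) e)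
Flagged-extend {n} b {fs} {bs} {e} (mkFlagged sound complete) = mkFlagged sound′ complete′
  where
  sound′ : ∀ i → (b ∷ newFlags b fs bs) ∋ i → Unrestricted (extend ((b ∷ bs) ‼_) e) i
  sound′ zero    refl = Unrestricted-extend-0 λ ()
  sound′ (suc i) p    = let q , none = ∈-newFlags⁻ b fs bs i p in Unrestricted-extend⁺ i (sound i q) none

  complete′ : ∀ i → i < suc n → Unrestricted (extend ((b ∷ bs) ‼_) e) i → (b ∷ newFlags b fs bs) ∋ i
  complete′ zero    _         (_ , d) = one b d
    where
    one : ∀ b → just b ≢ just false → just b ≡ just true
    one true  _ = refl
    one false d = contradiction refl d
  complete′ (suc i) (s≤s i<n) u = let u′ , none = Unrestricted-extend⁻ i u in ∈-newFlags⁺ b fs bs i (complete i i<n u′) none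

record Correct (C : Code n) : Set where
  constructor mkCorrect
  field
    tableau : Tableau (proj₁ C)
    flagged : Flagged (proj₂ C) (cell (proj₂ (proj₁ C)))

steps-correct : {C : Code n} {C′ : Code (suc n)} → Correct C → C′ ∈ steps C → Correct C′
steps-correct {C = (c , R) , fs} (mkCorrect (mkTableau shape valid) flagged) (here refl) = mkCorrect
  (mkTableau (Shape-∷ʳ⁺ R shape) (Valid-cong (≗₂-sym (cell-∷ʳ R)) valid))
  (Flagged-cong (≗₂-sym (cell-∷ʳ R)) (Flagged-∷ʳ fs R flagged))
steps-correct {C = C@((c , R) , fs)} (mkCorrect (mkTableau shape valid) flagged) (there p) with ∈-map⁻ (withColumn C) p
... | b ∷ bs , q , refl with ∈-newColumns⁻ false (true ∷ fs) (b ∷ bs) q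
...   | ≤ , inj₂ one = mkCorrect
  (mkTableau (Shape-prependColumn⁺ (b ∷ bs) R shape)
    (Valid-cong e≗ (Valid-extend⁺ valid one (λ i r → Flagged.sound flagged i (≤ (suc i) r)))))
  (Flagged-cong e≗ (Flagged-extend b flagged))
  where
  e≗ : extend ((b ∷ bs) ‼_) (cell R) ≗₂ cell (prependColumn (b ∷ bs) R)
  e≗ = ≗₂-sym (cell-prependColumn (b ∷ bs) R)

codes-sound : ∀ n {C} → C ∈ codes n → Correct C
codes-sound zero (here refl) = mkCorrect
  (mkTableau (mkShape z≤n (λ _ ()) (λ _ → z≤n) (λ _ → z≤n)) (mkValid (λ _ ()) (λ _ _ ()) (λ _ ())))
  (mkFlagged (λ _ ()) (λ _ ()))
codes-sound (suc n) p with find (∈-concatMap⁻ steps {xs = codes n} p)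
... | C , q , r = steps-correct (codes-sound n q) r

-- Induction along `↝-decompose`. Validity puts the 1s of a removed column in unrestricted rows;
-- completeness of the flags then shows that the column was listed.
codes-complete : ∀ n {P} → Tableau P → P ∈ map proj₁ (codes n)
codes-complete zero {zero , []} _ = here refl
codes-complete zero {suc c , []} (mkTableau (mkShape () _ _ _) _)
codes-complete (suc n) {c , S} (mkTableau shape valid) with ↝-decompose S shape
... | P , addRow {R = R} , shape′ with ∈-map⁻ proj₁ (codes-complete n (mkTableau shape′ (Valid-cong (cell-∷ʳ R) valid)))
...   | C , p , refl = ∈-map⁺ proj₁ (∈-concatMap⁺ steps (Any.map (λ { refl → here refl }) p))
codes-complete (suc n) {suc c , S} (mkTableau shape valid) | P , addColumn {R = R} bs , shape′
  with Valid-extend⁻ (Valid-cong (cell-prependColumn bs R) valid)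
... | valid′ , one , unrestricted with ∈-map⁻ proj₁ (codes-complete n (mkTableau shape′ valid′))
...   | C@(_ , fs) , p , refl =
  ∈-map⁺ proj₁ (∈-concatMap⁺ steps (Any.map (λ { refl → there (∈-map⁺ (withColumn C) admissible) }) p))
  where
  ones : ∀ i → bs ∋ i → (true ∷ fs) ∋ i
  ones zero    _ = refl
  ones (suc i) q = Flagged.complete (Correct.flagged (codes-sound n p)) i (ℕ.≤-pred (∋-bounded bs q)) (unrestricted i q)

  admissible : bs ∈ newColumns (true ∷ fs) false
  admissible = ∈-newColumns⁺ false (true ∷ fs) bs ones (inj₂ one)

-- The generating function of unrestricted rows and diagonal 1s

isOne : Maybe Bool → ℕ
isOne (just true)  = 1
isOne (just false) = 0
isOne nothing      = 0

-- Row i has its diagonal cell in column d i.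
diagonalCount : (ℕ → ℕ) → Rows n → ℕ
diagonalCount d []      = 0
diagonalCount d (r ∷ R) = isOne (fromList r ‼ d 0) + diagonalCount (d ∘ suc) R

diagonalCount-∷ʳ : ∀ d (R : Rows n) → diagonalCount d (R ∷ʳ []) ≡ diagonalCount d R
diagonalCount-∷ʳ d []      = refl
diagonalCount-∷ʳ d (r ∷ R) = cong (_+_ (isOne (fromList r ‼ d 0))) (diagonalCount-∷ʳ (d ∘ suc) R)

-- The new top row moves each old diagonal cell down and the new column moves it right, so it
-- remains diagonal.
diagonalCount-zipWith : ∀ d (bs : Vec Bool n) R → diagonalCount (suc ∘ d) (zipWith _∷_ bs R) ≡ diagonalCount d R
diagonalCount-zipWith d []       []      = refl
diagonalCount-zipWith d (b ∷ bs) (r ∷ R) = cong (_+_ (isOne (fromList r ‼ d 0))) (diagonalCount-zipWith (d ∘ suc) bs R)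

rawDiagonals : Raw n → ℕ
rawDiagonals (_ , R) = diagonalCount id R

flagWeight markedWeight : ℕ → Code n → ℕ
flagWeight   x (_ , fs)  = weight x fs
markedWeight x C@(P , _) = rawDiagonals P * flagWeight x C

-- Splits the steps into the empty row, the columns with diagonal entry 0 and those with diagonal
-- entry 1.
∑-steps : ∀ (f : Code (suc n) → ℕ) C → ∑ f (steps C) ≡
  f (withRow C) + (∑ (f ∘ withColumn C ∘ (false ∷_)) (newColumns (proj₂ C) false)
                 + ∑ (f ∘ withColumn C ∘ (true  ∷_)) (newColumns (proj₂ C) true))
∑-steps f C@(_ , fs) = cong (_+_ (f (withRow C))) (begin
  ∑ f (map (withColumn C) (map (false ∷_) bss₀ ++ map (true ∷_) bss₁))
    ≡⟨ ∑-map f (withColumn C) (map (false ∷_) bss₀ ++ map (true ∷_) bss₁) ⟩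
  ∑ g (map (false ∷_) bss₀ ++ map (true ∷_) bss₁)
    ≡⟨ ∑-++ g (map (false ∷_) bss₀) (map (true ∷_) bss₁) ⟩
  ∑ g (map (false ∷_) bss₀) + ∑ g (map (true ∷_) bss₁)
    ≡⟨ cong₂ _+_ (∑-map g (false ∷_) bss₀) (∑-map g (true ∷_) bss₁) ⟩
  ∑ (g ∘ (false ∷_)) bss₀ + ∑ (g ∘ (true ∷_)) bss₁ ∎)
  where
  open ≡-Reasoning
  bss₀ = newColumns fs false
  bss₁ = newColumns fs true
  g    = f ∘ withColumn C

-- The empty row and the columns with diagonal 0 together weigh x(1+x)^u, exactly as much as the
-- columns with diagonal 1.
∑-steps-flagWeight : ∀ x (C : Code n) → ∑ (flagWeight x) (steps C) ≡ 2 * x * flagWeight (suc x) C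
∑-steps-flagWeight x C@(_ , fs) = begin
  ∑ (flagWeight x) (steps C)
    ≡⟨ ∑-steps (flagWeight x) C ⟩
  weight x (fs ∷ʳ true) + (∑ v₀ (newColumns fs false) + ∑ (λ bs → x * v₁ bs) (newColumns fs true))
    ≡⟨ cong₂ _+_ (weight-∷ʳ x fs) (cong (_+_ (∑ v₀ (newColumns fs false))) (∑-*ˡ x v₁ (newColumns fs true))) ⟩
  x * weight x fs + (∑ v₀ (newColumns fs false) + x * ∑ v₁ (newColumns fs true))
    ≡⟨ ℕ.+-assoc (x * weight x fs) _ _ ⟨
  x * weight x fs + ∑ v₀ (newColumns fs false) + x * ∑ v₁ (newColumns fs true)
    ≡⟨ cong₂ _+_ (∑-newColumns-false x fs) (cong (x *_) (∑-newColumns-true x fs)) ⟩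
  x * weight (suc x) fs + x * weight (suc x) fs
    ≡⟨ double x (weight (suc x) fs) ⟩
  2 * x * weight (suc x) fs ∎
  where
  open ≡-Reasoning
  v₀ = weight x ∘ newFlags false fs
  v₁ = weight x ∘ newFlags true fs
  double : ∀ a b → a * b + a * b ≡ 2 * a * b
  double = solve-∀

-- One half of the weight 2x(1+x)^u keeps the number d of diagonal 1s and the other half raises it
-- to d + 1.
∑-steps-markedWeight : ∀ x (C : Code n) →
  ∑ (markedWeight x) (steps C) ≡ x * (flagWeight (suc x) C + 2 * markedWeight (suc x) C)
∑-steps-markedWeight x C@((c , R) , fs) = begin
  ∑ (markedWeight x) (steps C)
    ≡⟨ ∑-steps (markedWeight x) C ⟩
  diagonalCount id (R ∷ʳ []) * weight x (fs ∷ʳ true)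
    + (∑ (λ bs → diagonalCount suc (zipWith _∷_ bs R) * v₀ bs) (newColumns fs false)
     + ∑ (λ bs → suc (diagonalCount suc (zipWith _∷_ bs R)) * (x * v₁ bs)) (newColumns fs true))
    ≡⟨ cong₂ _+_ (cong₂ _*_ (diagonalCount-∷ʳ id R) (weight-∷ʳ x fs))
       (cong₂ _+_ (∑-cong (λ bs → cong (_* v₀ bs) (diagonalCount-zipWith id bs R)) (newColumns fs false))
                  (∑-cong (λ bs → cong (λ k → suc k * (x * v₁ bs)) (diagonalCount-zipWith id bs R)) (newColumns fs true))) ⟩
  d * (x * weight x fs)
    + (∑ (λ bs → d * v₀ bs) (newColumns fs false) + ∑ (λ bs → suc d * (x * v₁ bs)) (newColumns fs true))
    ≡⟨ cong (_+_ (d * (x * weight x fs))) (cong₂ _+_ (∑-*ˡ d v₀ (newColumns fs false))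
       (trans (∑-*ˡ (suc d) (λ bs → x * v₁ bs) (newColumns fs true)) (cong (suc d *_) (∑-*ˡ x v₁ (newColumns fs true))))) ⟩
  d * (x * weight x fs) + (d * ∑ v₀ (newColumns fs false) + suc d * (x * ∑ v₁ (newColumns fs true)))
    ≡⟨ factor d (x * weight x fs) (∑ v₀ (newColumns fs false)) (x * ∑ v₁ (newColumns fs true)) ⟩
  d * (x * weight x fs + ∑ v₀ (newColumns fs false)) + suc d * (x * ∑ v₁ (newColumns fs true))
    ≡⟨ cong₂ (λ a b → d * a + suc d * (x * b)) (∑-newColumns-false x fs) (∑-newColumns-true x fs) ⟩
  d * (x * weight (suc x) fs) + suc d * (x * weight (suc x) fs)
    ≡⟨ collect d x (weight (suc x) fs) ⟩
  x * (weight (suc x) fs + 2 * (d * weight (suc x) fs)) ∎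
  where
  open ≡-Reasoning
  d  = diagonalCount id R
  v₀ = weight x ∘ newFlags false fs
  v₁ = weight x ∘ newFlags true fs
  factor : ∀ d a b e → d * a + (d * b + suc d * e) ≡ d * (a + b) + suc d * e
  factor = solve-∀
  collect : ∀ d x w → d * (x * w) + suc d * (x * w) ≡ x * (w + 2 * (d * w))
  collect = solve-∀

-- The induction needs every `x`, since a step at `x` calls for the hypothesis at `suc x`. Only
-- afterwards is `x` set to 1, where all weights are 1 and the sums merely count.
∑-codes-markedWeight : ∀ n x → 2 * ∑ (markedWeight x) (codes n) ≡ n * ∑ (flagWeight x) (codes n)
∑-codes-markedWeight zero    x = refl
∑-codes-markedWeight (suc n) x = begin
  2 * ∑ (markedWeight x) (concatMap steps (codes n))
    ≡⟨ cong (2 *_) (trans (∑-concatMap (markedWeight x) steps (codes n)) (∑-cong (∑-steps-markedWeight x) (codes n))) ⟩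
  2 * ∑ (λ C → x * (flagWeight (suc x) C + 2 * markedWeight (suc x) C)) (codes n)
    ≡⟨ cong (2 *_) (trans (∑-*ˡ x _ (codes n)) (cong (x *_) (trans (∑-+ _ _ (codes n)) (cong (_+_ N) (∑-*ˡ 2 _ (codes n)))))) ⟩
  2 * (x * (N + 2 * ∑ (markedWeight (suc x)) (codes n)))
    ≡⟨ cong (λ M → 2 * (x * (N + M))) (∑-codes-markedWeight n (suc x)) ⟩
  2 * (x * (N + n * N))
    ≡⟨ rearrange n x N ⟩
  suc n * (2 * x * N)
    ≡⟨ cong (suc n *_) (∑-*ˡ (2 * x) (flagWeight (suc x)) (codes n)) ⟨
  suc n * ∑ (λ C → 2 * x * flagWeight (suc x) C) (codes n)
    ≡⟨ cong (suc n *_) (trans (∑-concatMap (flagWeight x) steps (codes n)) (∑-cong (∑-steps-flagWeight x) (codes n))) ⟨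
  suc n * ∑ (flagWeight x) (concatMap steps (codes n)) ∎
  where
  open ≡-Reasoning
  N = ∑ (flagWeight (suc x)) (codes n)
  rearrange : ∀ n x N → 2 * (x * (N + n * N)) ≡ suc n * (2 * x * N)
  rearrange = solve-∀

∑-codes-rawDiagonals : ∀ n → 2 * ∑ (rawDiagonals ∘ proj₁) (codes n) ≡ n * length (codes n)
∑-codes-rawDiagonals n = begin
  2 * ∑ (rawDiagonals ∘ proj₁) (codes n)
    ≡⟨ cong (2 *_) (∑-cong (λ (P , fs) → trans (cong (rawDiagonals P *_) (weight-1 fs)) (ℕ.*-identityʳ _)) (codes n)) ⟨
  2 * ∑ (markedWeight 1) (codes n)
    ≡⟨ ∑-codes-markedWeight n 1 ⟩
  n * ∑ (flagWeight 1) (codes n)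
    ≡⟨ cong (n *_) (trans (∑-cong (λ (_ , fs) → weight-1 fs) (codes n)) (∑-1 (codes n))) ⟩
  n * length (codes n) ∎
  where open ≡-Reasoning

-- Tableaux as lists of rows

cell-defined⁻ : ∀ (R : Rows n) {b} → cell R i j ≡ just b → i < n × j < rowLength R i
cell-defined⁻ {i = zero}  (r ∷ R) p = s≤s z≤n , ‼-bounded r p
  where
  ‼-bounded : ∀ {j b} (r : List Bool) → fromList r ‼ j ≡ just b → j < length r
  ‼-bounded {zero}  (_ ∷ r) _ = s≤s z≤n
  ‼-bounded {suc _} (_ ∷ r) p = s≤s (‼-bounded r p)
cell-defined⁻ {i = suc _} (r ∷ R) p = let i<n , j<len = cell-defined⁻ R p in s≤s i<n , j<len

cell-defined⁺ : ∀ (R : Rows n) → j < rowLength R i → ∃[ b ] cell R i j ≡ just b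
cell-defined⁺ {i = zero}  (r ∷ R) j<len = ‼-defined r j<len
  where
  ‼-defined : ∀ {j} (r : List Bool) → j < length r → ∃[ b ] fromList r ‼ j ≡ just b
  ‼-defined {zero}  (b ∷ r) _         = b , refl
  ‼-defined {suc _} (b ∷ r) (s≤s j<l) = ‼-defined r j<l
cell-defined⁺ {i = suc _} (r ∷ R) j<len = cell-defined⁺ R j<len

infixl 7 _at_

-- Lengths beyond the last row are 0.
_at_ : Vec ℕ n → ℕ → ℕ
[]       at _     = 0
(l ∷ ls) at zero  = l
(l ∷ ls) at suc i = ls at i

rowsOf : {ls : Vec ℕ n} → All (Vec Bool) ls → Rows n
rowsOf = All.reduce toList

rowLength-rowsOf : {ls : Vec ℕ n} (T : All (Vec Bool) ls) → ∀ i → rowLength (rowsOf T) i ≡ ls at i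
rowLength-rowsOf []      i       = refl
rowLength-rowsOf (r ∷ T) zero    = Vec.length-toList r
rowLength-rowsOf (r ∷ T) (suc i) = rowLength-rowsOf T i

cell-rowsOf : {ls : Vec ℕ n} (T : All (Vec Bool) ls) (i : Fin n) (j : ℕ) →
              All.lookup⁺ T i ‼ j ≡ cell (rowsOf T) (toℕ i) j
cell-rowsOf (r ∷ T) Fin.zero    j = ‼-toList r j
  where
  ‼-toList : ∀ {l} (r : Vec Bool l) j → r ‼ j ≡ fromList (toList r) ‼ j
  ‼-toList []      j       = refl
  ‼-toList (b ∷ r) zero    = refl
  ‼-toList (b ∷ r) (suc j) = ‼-toList r j
cell-rowsOf (r ∷ T) (Fin.suc i) j = cell-rowsOf T i j

rowsOf-lengths : {ls : Vec ℕ n} (T : All (Vec Bool) ls) → Vec.map length (rowsOf T) ≡ ls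
rowsOf-lengths []      = refl
rowsOf-lengths (r ∷ T) = cong₂ _∷_ (Vec.length-toList r) (rowsOf-lengths T)

rowsOf-injective : {ls : Vec ℕ n} (T T′ : All (Vec Bool) ls) → rowsOf T ≡ rowsOf T′ → T ≡ T′
rowsOf-injective []      []        _  = refl
rowsOf-injective (r ∷ T) (r′ ∷ T′) eq = cong₂ _∷_
  (trans (sym (Vec.cast-is-id refl r)) (Vec.toList-injective refl r r′ (Vec.∷-injectiveˡ eq)))
  (rowsOf-injective T T′ (Vec.∷-injectiveʳ eq))

rowsOf-surjective : (R : Rows n) → ∃[ T ] rowsOf {ls = Vec.map length R} T ≡ R
rowsOf-surjective []      = [] , refl
rowsOf-surjective (r ∷ R) with rowsOf-surjective R
... | T , eq = fromList r ∷ T , cong₂ _∷_ (Vec.toList∘fromList r) eq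

at-tabulate : ∀ (f : ℕ → ℕ) (ls : Vec ℕ m) → i < c → (tabulate {n = c} (f ∘ toℕ) Vec.++ ls) at i ≡ f i
at-tabulate {i = zero}  {c = suc c} f ls _         = refl
at-tabulate {i = suc i} {c = suc c} f ls (s≤s i<c) = at-tabulate (f ∘ suc) ls i<c

at-++ : ∀ (ks : Vec ℕ c) (ls : Vec ℕ m) k → (ks Vec.++ ls) at (c + k) ≡ ls at k
at-++ []       ls k = refl
at-++ (_ ∷ ks) ls k = at-++ ks ls k

at-bounded : {ls : Vec ℕ m} → All (_≤ c) ls → ∀ k → ls at k ≤ c
at-bounded []       k       = z≤n
at-bounded (p ∷ ps) zero    = p
at-bounded (p ∷ ps) (suc k) = at-bounded ps k

at-decreasing : {ls : Vec ℕ m} → Linked _≥_ ls → ∀ k → ls at (suc k) ≤ ls at k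
at-decreasing []       k       = z≤n
at-decreasing [-]      k       = z≤n
at-decreasing {ls = _ ∷ _ ∷ _} (p ∷ ps) zero    = p
at-decreasing {ls = _ ∷ _ ∷ _} (p ∷ ps) (suc k) = at-decreasing ps k

bounded-at : (ls : Vec ℕ m) → (∀ k → ls at k ≤ c) → All (_≤ c) ls
bounded-at []       p = []
bounded-at (l ∷ ls) p = p 0 ∷ bounded-at ls (p ∘ suc)

decreasing-at : (ls : Vec ℕ m) → (∀ k → ls at (suc k) ≤ ls at k) → Linked _≥_ ls
decreasing-at []           p = []
decreasing-at (l ∷ [])     p = [-]
decreasing-at (l ∷ k ∷ ls) p = p 0 ∷ decreasing-at (k ∷ ls) (p ∘ suc)

module _ (D : FerrersDiagram) (bounded : All (_≤ columns D) (rowLengths D)) (decreasing : Linked _≥_ (rowLengths D))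
         (T : Filling D) where

  private
    R : Rows (columns D + rows D)
    R = rowsOf T

    staircase : Vec ℕ (columns D)
    staircase = tabulate (suc ∘ toℕ)

  rowLength-below : ∀ k → rowLength R (columns D + k) ≡ rowLengths D at k
  rowLength-below k = trans (rowLength-rowsOf T (columns D + k)) (at-++ staircase (rowLengths D) k)

  shape-rowsOf : Shape (columns D) R
  shape-rowsOf = mkShape (ℕ.m≤m+n (columns D) (rows D))
    (λ i i<c → trans (rowLength-rowsOf T i) (at-tabulate suc (rowLengths D) i<c))
    (λ k → subst (_≤ columns D) (sym (rowLength-below k)) (at-bounded bounded k))
    (λ k → subst₂ _≤_ (sym (trans (cong (rowLength R) (sym (ℕ.+-suc (columns D) k))) (rowLength-below (suc k))))
                      (sym (rowLength-below k)) (at-decreasing decreasing k))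

  rowLength-≤-columns : ∀ i → rowLength R i ≤ columns D
  rowLength-≤-columns i with ℕ.<-≤-connex i (columns D)
  ... | inj₁ i<c = subst (_≤ columns D) (sym (Shape.staircase shape-rowsOf i i<c)) i<c
  ... | inj₂ c≤i with ℕ.m≤n⇒∃[o]m+o≡n c≤i
  ...   | k , refl = Shape.box shape-rowsOf k

  -- A defined cell has its indices in range, which allows the passage from natural numbers back to
  -- `Fin`.
  locate : ∀ {i j b} → cell R i j ≡ just b → ∃₂ λ (p : Row D T) (q : Column D T) → toℕ p ≡ i × toℕ q ≡ j
  locate {i} {j} eq with cell-defined⁻ R eq
  ... | i<n , j<len = fromℕ< i<n , fromℕ< j<c , Fin.toℕ-fromℕ< i<n , Fin.toℕ-fromℕ< j<c
    where
    j<c : j < columns D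
    j<c = ℕ.<-≤-trans j<len (rowLength-≤-columns i)

  entry-cell : ∀ p q → entry D T p q ≡ cell R (toℕ p) (toℕ q)
  entry-cell p q = cell-rowsOf T p (toℕ q)

  toℕ-inserted : ∀ d → toℕ (inserted D T d) ≡ toℕ d
  toℕ-inserted d = Fin.toℕ-↑ˡ d (rows D)

  inserted-cell : ∀ d q → entry D T (inserted D T d) q ≡ cell R (toℕ d) (toℕ q)
  inserted-cell d q = trans (entry-cell (inserted D T d) q) (cong (λ i → cell R i (toℕ q)) (toℕ-inserted d))

  rowLength-inserted : ∀ (d : Column D T) → rowLength R (toℕ d) ≡ suc (toℕ d)
  rowLength-inserted d = Shape.staircase shape-rowsOf (toℕ d) (Fin.toℕ<n d)

  isTypeB⇒valid : IsTypeB D T → Valid (columns D) (cell R)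
  isTypeB⇒valid (mkIsTypeB column-has-1 0-restricted diagonal-0) = mkValid column zeros diagonal
    where
    column : ∀ j → j < columns D → ∃[ i ] cell R i j ≡ just true
    column j j<c with column-has-1 (fromℕ< j<c)
    ... | p , eq = toℕ p , trans (cong (cell R (toℕ p)) (sym (Fin.toℕ-fromℕ< j<c))) (trans (sym (entry-cell p (fromℕ< j<c))) eq)

    zeros : ∀ i j → cell R i j ≡ just false → Above (cell R) i j → ¬ Left (cell R) i j
    zeros i j eq (i′ , i′<i , above) (j′ , j′<j , left) with locate eq
    ... | p , q , refl , refl with locate above | locate left
    ...   | p′ , q₁ , refl , q₁≡q | p₁ , q′ , p₁≡p , refl =
      0-restricted p q (trans (entry-cell p q) eq)
        ((p′ , i′<i , trans (entry-cell p′ q) above) , (q′ , j′<j , trans (entry-cell p q′) left))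

    diagonal : ∀ i → cell R i i ≡ just false → ∀ j → cell R i j ≢ just true
    -- The cell in row `i` and column `i` exists, so `i` is a column index `d` and row `i` is the
    -- row inserted for it.
    diagonal i eq j one with locate eq | locate one
    ... | p , d , _ , refl | p′ , q , _ , refl =
      contradiction (trans (sym one) (trans (sym (inserted-cell d q)) (diagonal-0 d (trans (inserted-cell d d) eq) q q≤d))) λ ()
      where
      -- Row `d` has length `d + 1`, so its 1 lies weakly to the left of the diagonal, where
      -- `diagonal-0` demands a 0.
      q≤d : toℕ q ≤ toℕ d
      q≤d = ℕ.≤-pred (subst (toℕ q <_) (rowLength-inserted d) (proj₂ (cell-defined⁻ R one)))

  valid⇒isTypeB : Valid (columns D) (cell R) → IsTypeB D T
  valid⇒isTypeB (mkValid column zeros diagonal) = mkIsTypeB column-has-1 0-restricted diagonal-0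
    where
    column-has-1 : ∀ j → ∃[ i ] entry D T i j ≡ just true
    column-has-1 q with column (toℕ q) (Fin.toℕ<n q)
    ... | i , eq with locate eq
    ...   | p , _ , refl , _ = p , trans (entry-cell p q) eq

    0-restricted : ∀ i j → entry D T i j ≡ just false → ¬ (OneAbove D T i j × OneToLeft D T i j)
    0-restricted p q eq ((p′ , p′<p , above) , (q′ , q′<q , left)) =
      zeros (toℕ p) (toℕ q) (trans (sym (entry-cell p q)) eq)
        (toℕ p′ , p′<p , trans (sym (entry-cell p′ q)) above) (toℕ q′ , q′<q , trans (sym (entry-cell p q′)) left)

    diagonal-0 : ∀ d → diagonalEntry D T d ≡ just false → ∀ j → j Fin.≤ d → entry D T (inserted D T d) j ≡ just false
    diagonal-0 d eq q q≤d with cell-defined⁺ R (subst (toℕ q <_) (sym (rowLength-inserted d)) (s≤s q≤d))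
    ... | false , p = trans (inserted-cell d q) p
    ... | true  , p = contradiction p (diagonal (toℕ d) (trans (sym (inserted-cell d d)) eq) (toℕ q))

-- The left side runs over columns, the right side over rows; `outside` says that rows without a
-- matching column contribute nothing. `f` and `d` are arbitrary so that the recursion can shift
-- both.
length-filter-diagonal : ∀ {P : A → Set} (P? : Decidable P) (f : Fin c → A) (d : ℕ → ℕ) (R : Rows m) →
  (∀ i → P (f i) → cell R (toℕ i) (d (toℕ i)) ≡ just true) →
  (∀ i → cell R (toℕ i) (d (toℕ i)) ≡ just true → P (f i)) →
  (∀ i → c ≤ i → cell R i (d i) ≢ just true) →
  length (filter P? (List.tabulate f)) ≡ diagonalCount d R
length-filter-diagonal {c = zero}  P? f d []      to from outside = refl
length-filter-diagonal {c = zero}  P? f d (r ∷ R) to from outside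
  with fromList r ‼ d 0 | outside 0 z≤n
... | just true  | ≢1 = contradiction refl ≢1
... | just false | _  = length-filter-diagonal P? f (d ∘ suc) R (λ ()) (λ ()) (λ i _ → outside (suc i) z≤n)
... | nothing    | _  = length-filter-diagonal P? f (d ∘ suc) R (λ ()) (λ ()) (λ i _ → outside (suc i) z≤n)
length-filter-diagonal {c = suc c} P? f d []      to from outside with P? (f Fin.zero)
... | yes p = contradiction (to Fin.zero p) λ ()
... | no _  = length-filter-diagonal P? (f ∘ Fin.suc) (d ∘ suc) [] (to ∘ Fin.suc) (λ _ ()) (λ _ _ ())
length-filter-diagonal {c = suc c} P? f d (r ∷ R) to from outside
  with P? (f Fin.zero) | fromList r ‼ d 0 | to Fin.zero | from Fin.zero
     | length-filter-diagonal P? (f ∘ Fin.suc) (d ∘ suc) R (to ∘ Fin.suc) (from ∘ Fin.suc) (λ i c≤i → outside (suc i) (s≤s c≤i))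
... | yes p | just true  | _    | _     | eq = cong suc eq
... | yes p | just false | to₀  | _     | _  = contradiction (to₀ p) λ ()
... | yes p | nothing    | to₀  | _     | _  = contradiction (to₀ p) λ ()
... | no ¬p | just true  | _    | from₀ | _  = contradiction (from₀ refl) ¬p
... | no ¬p | just false | _    | _     | eq = eq
... | no ¬p | nothing    | _    | _     | eq = eq

-- The bijection between type-B tableaux and valid lists of rows

-- The proof of the size is irrelevant, and `cast` accepts an irrelevant equation.
raw : 𝓑 n → Raw n
raw (mk𝓑 D T s _) = columns D , cast (trans (ℕ.+-comm (columns D) (rows D)) s) (rowsOf T)

Tableau-cast : ∀ .(eq : m ≡ n) {R : Rows m} → Tableau (c , R) → Tableau (c , cast eq R)
Tableau-cast {m} {n} {c} eq {R} t = go (recompute (m ℕ.≟ n) eq)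
  where
  go : (eq : m ≡ n) → Tableau (c , cast eq R)
  go refl = subst (λ R → Tableau (c , R)) (sym (Vec.cast-is-id refl R)) t

diagonalCount-cast : ∀ .(eq : m ≡ n) d (R : Rows m) → diagonalCount d (cast eq R) ≡ diagonalCount d R
diagonalCount-cast {n = zero}  eq d []      = refl
diagonalCount-cast {n = suc _} eq d (r ∷ R) = cong (_+_ (isOne (fromList r ‼ d 0))) (diagonalCount-cast (ℕ.suc-injective eq) (d ∘ suc) R)

cast-injective : ∀ .(eq : m ≡ n) (xs ys : Vec A m) → cast eq xs ≡ cast eq ys → xs ≡ ys
cast-injective {n = zero}  eq []       []       _ = refl
cast-injective {n = suc _} eq (x ∷ xs) (y ∷ ys) p =
  cong₂ _∷_ (Vec.∷-injectiveˡ p) (cast-injective _ xs ys (Vec.∷-injectiveʳ p))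

-- The side condition is decidable, so a relevant proof can be recomputed from the irrelevant field.
bounded! : (D : FerrersDiagram) → All (_≤ columns D) (rowLengths D)
bounded! (mkFerrers _ c ls b _) = recompute (All.all? (ℕ._≤? c) ls) b

decreasing! : (D : FerrersDiagram) → Linked _≥_ (rowLengths D)
decreasing! (mkFerrers _ _ ls _ d) = recompute (Linked.linked? (λ x y → y ℕ.≤? x) ls) d

raw-tableau : (T : 𝓑 n) → Tableau (raw T)
raw-tableau (mk𝓑 D T s t) = Tableau-cast _ (mkTableau (shape-rowsOf D (bounded! D) (decreasing! D) T)
  (isTypeB⇒valid D (bounded! D) (decreasing! D) T (recompute (isTypeB? D T) t)))

raw-diagonals : (T : 𝓑 n) → rawDiagonals (raw T) ≡ diagonal1s T
raw-diagonals (mk𝓑 D T s t) = trans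
  (diagonalCount-cast (trans (ℕ.+-comm (columns D) (rows D)) s) id (rowsOf T))
  (sym (length-filter-diagonal _ id id (rowsOf T)
  (λ d p → trans (sym (inserted-cell′ d)) p)
  (λ d p → trans (inserted-cell′ d) p)
  (λ i c≤i p → ℕ.<⇒≱ (ℕ.<-≤-trans (proj₂ (cell-defined⁻ (rowsOf T) p))
                                   (rowLength-≤-columns D (bounded! D) (decreasing! D) T i)) c≤i)))
  where
  inserted-cell′ : ∀ d → diagonalEntry D T d ≡ cell (rowsOf T) (toℕ d) (toℕ d)
  inserted-cell′ d = inserted-cell D (bounded! D) (decreasing! D) T d d

rowsOf-injective-++ : ∀ (ks : Vec ℕ c) {ls ls′ : Vec ℕ m}
  (T : All (Vec Bool) (ks Vec.++ ls)) (T′ : All (Vec Bool) (ks Vec.++ ls′)) →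
  rowsOf T ≡ rowsOf T′ → ls ≡ ls′
rowsOf-injective-++ ks T T′ eq = Vec.++-injectiveʳ ks ks
  (trans (sym (rowsOf-lengths T)) (trans (cong (Vec.map length) eq) (rowsOf-lengths T′)))

-- The number of columns and the size fix the number of rows; the lists fix the row lengths and then
-- the entries. The remaining fields are irrelevant.
raw-injective : {T T′ : 𝓑 n} → raw T ≡ raw T′ → T ≡ T′
raw-injective {T = mk𝓑 (mkFerrers r c ls _ _) T s _} {mk𝓑 (mkFerrers r′ c′ ls′ _ _) T′ s′ _} eq with cong proj₁ eq
... | refl with ℕ.+-cancelʳ-≡ c r r′ (trans (recompute (_ ℕ.≟ _) s) (sym (recompute (_ ℕ.≟ _) s′)))
...   | refl with cast-injective _ (rowsOf T) (rowsOf T′) (cong proj₂ eq)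
...     | R≡R′ with rowsOf-injective-++ (tabulate {n = c} (suc ∘ toℕ)) {ls} {ls′} T T′ R≡R′
...       | refl with rowsOf-injective T T′ R≡R′
...         | refl = refl

split-lengths : ∀ c (f : ℕ → ℕ) (R : Rows (c + m)) → (∀ i → i < c → rowLength R i ≡ f i) →
  ∃[ ls ] Vec.map length R ≡ tabulate {n = c} (f ∘ toℕ) Vec.++ ls × (∀ k → rowLength R (c + k) ≡ ls at k)
split-lengths zero    f R       _         = Vec.map length R , refl , lengths R
  where
  lengths : ∀ {m} (R : Rows m) k → rowLength R k ≡ Vec.map length R at k
  lengths []      k       = refl
  lengths (r ∷ R) zero    = refl
  lengths (r ∷ R) (suc k) = lengths R k
split-lengths (suc c) f (r ∷ R) staircase with split-lengths c (f ∘ suc) R (λ i i<c → staircase (suc i) (s≤s i<c))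
... | ls , eq , at≡ = ls , cong₂ _∷_ (staircase 0 (s≤s z≤n)) eq , at≡

raw-surjective : {P : Raw n} → Tableau P → ∃[ T ] raw T ≡ P
raw-surjective {P = c , R} (mkTableau shape@(mkShape c≤n staircase box weak) valid) with ℕ.m≤n⇒∃[o]m+o≡n c≤n
... | r , refl with split-lengths c suc R staircase
-- Fillings are indexed by the row lengths, so the filling is transported to lengths of the form
-- staircase followed by `ls`.
...   | ls , eq , at≡ with subst (λ ks → ∃[ T ] rowsOf {ls = ks} T ≡ R) eq (rowsOf-surjective R)
...     | T , refl = mk𝓑 D T (ℕ.+-comm r c) (valid⇒isTypeB D b d T valid) , cong (c ,_) (Vec.cast-is-id refl (rowsOf T))
  where
  b : All (_≤ c) ls
  b = bounded-at ls λ k → subst (_≤ c) (at≡ k) (box k)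

  d : Linked _≥_ ls
  d = decreasing-at ls λ k →
    subst₂ _≤_ (trans (cong (rowLength R) (sym (ℕ.+-suc c k))) (at≡ (suc k))) (at≡ k) (weak k)

  D : FerrersDiagram
  D = mkFerrers r c ls b d

-- Counting diagonal 1s over all tableaux

-- Both lists are free of duplicates and have the same members, so they are permutations of each
-- other and give equal sums and lengths.
raw-elements : ∀ n → map raw (elements (𝓑ᴱ n)) ↭ map proj₁ (codes n)
raw-elements n = ∼bag⇒↭ (unique∧set⇒bag (Unique.map⁺ raw-injective (unique (𝓑ᴱ n))) (codes-unique n) (mk⇔ to from))
  where
  to : ∀ {P} → P ∈ map raw (elements (𝓑ᴱ n)) → P ∈ map proj₁ (codes n)
  to p with ∈-map⁻ raw p
  ... | T , _ , refl = codes-complete n (raw-tableau T)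

  from : ∀ {P} → P ∈ map proj₁ (codes n) → P ∈ map raw (elements (𝓑ᴱ n))
  from p with ∈-map⁻ proj₁ p
  ... | C , q , refl with raw-surjective (Correct.tableau (codes-sound n q))
  ...   | T , eq = subst (_∈ map raw (elements (𝓑ᴱ n))) eq (∈-map⁺ raw (complete (𝓑ᴱ n) T))

∑-diagonal1s : ∀ n → 2 * ∑ diagonal1s (elements (𝓑ᴱ n)) ≡ n * length (elements (𝓑ᴱ n))
∑-diagonal1s n = begin
  2 * ∑ diagonal1s E
    ≡⟨ cong (2 *_) (∑-cong raw-diagonals E) ⟨
  2 * ∑ (rawDiagonals ∘ raw) E
    ≡⟨ cong (2 *_) (∑-map rawDiagonals raw E) ⟨
  2 * ∑ rawDiagonals (map raw E)
    ≡⟨ cong (2 *_) (sum-↭ (Perm.map⁺ rawDiagonals (raw-elements n))) ⟩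
  2 * ∑ rawDiagonals (map proj₁ (codes n))
    ≡⟨ cong (2 *_) (∑-map rawDiagonals proj₁ (codes n)) ⟩
  2 * ∑ (rawDiagonals ∘ proj₁) (codes n)
    ≡⟨ ∑-codes-rawDiagonals n ⟩
  n * length (codes n)
    ≡⟨ cong (n *_) (List.length-map proj₁ (codes n)) ⟨
  n * length (map proj₁ (codes n))
    ≡⟨ cong (n *_) (Perm.↭-length (raw-elements n)) ⟨
  n * length (map raw E)
    ≡⟨ cong (n *_) (List.length-map raw E) ⟩
  n * length E ∎
  where
  open ≡-Reasoning
  E = elements (𝓑ᴱ n)

-- From counts to the rational expectation

/1-homo-+ : ∀ a b → + a / 1 ℚ.+ + b / 1 ≡ + (a + b) / 1
/1-homo-+ a b = ℚ.toℚᵘ-injective (begin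
  toℚᵘ (+ a / 1 ℚ.+ + b / 1)
    ≈⟨ ℚ.toℚᵘ-homo-+ (+ a / 1) (+ b / 1) ⟩
  toℚᵘ (+ a / 1) ℚᵘ.+ toℚᵘ (+ b / 1)
    ≈⟨ ℚᵘ.+-cong (ℚ.toℚᵘ-fromℚᵘ (ℚᵘ.mkℚᵘ (+ a) 0)) (ℚ.toℚᵘ-fromℚᵘ (ℚᵘ.mkℚᵘ (+ b) 0)) ⟩
  ℚᵘ.mkℚᵘ (+ a) 0 ℚᵘ.+ ℚᵘ.mkℚᵘ (+ b) 0
    ≡⟨ cong (λ i → ℚᵘ.mkℚᵘ i 0) (cong₂ ℤ._+_ (ℤ.*-identityʳ (+ a)) (ℤ.*-identityʳ (+ b))) ⟩
  ℚᵘ.mkℚᵘ (+ (a + b)) 0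
    ≈⟨ ℚ.toℚᵘ-fromℚᵘ (ℚᵘ.mkℚᵘ (+ (a + b)) 0) ⟨
  toℚᵘ (+ (a + b) / 1) ∎)
  where open ℚᵘ.≃-Reasoning

sumℚ-/1 : (f : A → ℕ) (xs : List A) → sumℚ (map (λ x → + f x / 1) xs) ≡ + ∑ f xs / 1
sumℚ-/1 f []       = refl
sumℚ-/1 f (x ∷ xs) = trans (cong (ℚ._+_ (+ f x / 1)) (sumℚ-/1 f xs)) (/1-homo-+ (f x) (∑ f xs))

-- In unnormalised rationals equality is cross-multiplication, which turns the claim into the
-- hypothesis.
average : ∀ S L n .{{_ : NonZero L}} → 2 * S ≡ n * L → (+ S / 1) ℚ.* (+ 1 / L) ≡ + n / 2
average S L@(suc l) n eq = ℚ.toℚᵘ-injective (begin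
  toℚᵘ ((+ S / 1) ℚ.* (+ 1 / L))
    ≈⟨ ℚ.toℚᵘ-homo-* (+ S / 1) (+ 1 / L) ⟩
  toℚᵘ (+ S / 1) ℚᵘ.* toℚᵘ (+ 1 / L)
    ≈⟨ ℚᵘ.*-cong (ℚ.toℚᵘ-fromℚᵘ (ℚᵘ.mkℚᵘ (+ S) 0)) (ℚ.toℚᵘ-fromℚᵘ (ℚᵘ.mkℚᵘ (+ 1) l)) ⟩
  ℚᵘ.mkℚᵘ (+ S) 0 ℚᵘ.* ℚᵘ.mkℚᵘ (+ 1) l
    ≈⟨ ℚᵘ.*≡* cross ⟩
  ℚᵘ.mkℚᵘ (+ n) 1
    ≈⟨ ℚ.toℚᵘ-fromℚᵘ (ℚᵘ.mkℚᵘ (+ n) 1) ⟨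
  toℚᵘ (+ n / 2) ∎)
  where
  open ℚᵘ.≃-Reasoning
  cross : (+ S ℤ.* + 1) ℤ.* + 2 ≡ + n ℤ.* + (1 * L)
  cross = trans (cong (ℤ._* + 2) (ℤ.*-identityʳ (+ S))) (trans (sym (ℤ.pos-* S 2))
    (trans (cong +_ (trans (ℕ.*-comm S 2) (trans eq (cong (n *_) (sym (ℕ.*-identityˡ L)))))) (ℤ.pos-* n (1 * L))))

mainTheorem7 : (n : ℕ) → 𝔼 n (λ T → + diagonal1s T / 1) ≡ + n / 2
mainTheorem7 n = trans
  (cong (ℚ._* (+ 1 / length E)) (sumℚ-/1 diagonal1s E))
  (average (∑ diagonal1s E) (length E) n (∑-diagonal1s n))
  where
  E = elements (𝓑ᴱ n)
  instance
    E-nonEmpty : NonZero (length E)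
    E-nonEmpty = 𝓑-nonEmpty n
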